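{- Let $\mu$ be a super-strict partition with $|\mu|\ge 2$, and let $\tau=(\mu_1-1,\mu_2,\mu_3,\ldots)$, so that $\mu=\tau+(1)$. Then $$\Theta_\mu\!\left(\frac{zt}{1-zt}\right)=F_{\tau}(z,1)+F_{\tau,\mu}(z,t).$$ In particular $F_\mu(z,1)=\left.\Theta_\mu\!\left(\frac{zt}{1-zt}\right)\right|_{t=1}$, i.e. $\sum_{n\ge1}|\mathrm{Av}_n(\mu)|z^n$ equals this specialization.
   Context: A partition is a weakly decreasing sequence $\alpha_1\ge\alpha_2\ge\cdots$ of nonnegative integers with finitely many nonzero terms (its parts); its weight is $|\alpha|=\sum_i\alpha_i$. A partition is identified with its Ferrers board (row $i$ has $\alpha_i$ boxes, rows top- and left-justified). A partition $\alpha$ contains $\mu$ if one can delete some set of rows and some set of columns from the Ferrers board of $\alpha$ so that, after top/left-justifying the remaining boxes, one obtains the Ferrers board of $\mu$; otherwise $\alpha$ avoids $\mu$. $\mathrm{Av}_n(\mu)$ is the set of partitions of weight $n$ avoiding $\mu$. A partition is strict if its positive parts are distinct, and super-strict if any two of its positive parts differ by at least $2$. For partitions $\alpha,\beta$, $\alpha+\beta=(\alpha_1+\beta_1,\alpha_2+\beta_2,\ldots)$; $(w^m)$ denotes the partition with $m$ parts equal to $w$. $m(\alpha)$ is the multiplicity of the largest part $\alpha_1$ in $\alpha$. For partitions $\tau,\mu$, $\mathcal Q(\tau,\mu)$ is the set of partitions of positive weight that contain $\tau$ and avoid $\mu$. For a set $S$ of partitions, $F_S(z,t)=\sum_{\alpha\in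 S}z^{|\alpha|}t^{m(\alpha)}$ ($F_\emptyset=0$); $F_\mu(z,t)$ denotes $F_S$ for $S$ the set of partitions of positive weight avoiding $\mu$, and $F_{\tau,\mu}(z,t)=F_{\mathcal Q(\tau,\mu)}(z,t)$. Operators on series $G(z,t)=\sum_{n\ge1}\sum_{m\ge0}a_{n,m}z^nt^m$: $\mathcal E G(z,t)=\dfrac{G(z,1)-ztG(z,zt)}{1-zt}$, and $\mathcal N G(z,t)=G(z,0)+\sum_{n\ge1}\sum_{m\ge1}a_{n,m}\dfrac{1}{1-z^m}\cdot\dfrac{1-(tz)^m}{1-tz}z^n$. The southeast border of a partition $\mu$ is the lattice path of unit east and north steps from the bottom-left to the top-right corner of its Ferrers board tracing the bottoms of the columns and right ends of the rows. For strict $\mu$ every north step other than the last is immediately followed by an east step; such a pair is called a north-east step, so the border is read as: an initial east step, then a sequence of east and north-east steps, then a final north step. For super-strict $\mu$ of weight $\ge2$, $\Theta_\mu$ is the sequence of symbols obtained by reading this border from bottom-left to top-right, ignoring the initial east step and the final east step followed by the final north step, and recording each east step as $\mathcal E$ and each north-east step as $\mathcal N$ (e.g. $\Theta_{(8,5,3)}=(\mathcal E,\mathcal E,\mathcal N,\mathcal E,\mathcal N,\mathcal E)$, $\Theta_{(2)}=\emptyset$). For $\Theta=(\Theta_1,\ldots,\Theta_r)$, $\Theta G=\Theta_r\circ\cdots\circ\Theta_1 G$, and $\emptyset G=G$. -}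

module Defs where

open import Data.Nat using (ℕ; zero; suc; _+_; _*_; _∸_; _≤_; _<_; _≥_; z≤n; s≤s; s≤s⁻¹; ∣_-_∣; _≟_; _<?_)
open import Data.Nat.Properties
open import Data.Integer using (ℤ; 0ℤ; 1ℤ) renaming (+_ to pos; -_ to -ℤ_; _+_ to _+ℤ_; _*_ to _*ℤ_)
open import Data.Bool using (if_then_else_)
open import Data.List using (List; []; _∷_; _++_; map; foldr; foldl; filter; length; replicate; upTo)
open import Data.Nat.ListAction using (sum)
open import Data.List.Membership.Propositional using (_∈_)
open import Data.List.Membership.Propositional.Properties using (∈-map⁺; ∈-map⁻; ∈-++⁺ˡ; ∈-++⁺ʳ; ∈-filter⁺; ∈-filter⁻)
open import Data.List.Properties using (≡-dec; ∷-injectiveʳ)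
open import Data.List.Relation.Unary.All as All using (All; []; _∷_)
import Data.List.Relation.Unary.All.Properties as Allₚ
open import Data.List.Relation.Unary.AllPairs using (AllPairs; []; _∷_)
open import Data.List.Relation.Unary.Any using (here; there)
open import Data.List.Relation.Unary.Linked as Linked using (Linked; []; [-]; _∷_)
open import Data.List.Relation.Unary.Linked.Properties using (Linked⇒All)
open import Data.List.Relation.Unary.Unique.Propositional using (Unique)
import Data.List.Relation.Unary.Unique.Propositional.Properties as Uniqueₚ
open import Data.Fin.Subset using (Subset; inside; outside)
open import Data.Fin.Subset.Properties using (anySubset?)
open import Data.Product using (∃; _×_; _,_; proj₁; proj₂)
open import Data.Sum using (inj₁; inj₂)
open import Data.Vec using ([]; _∷_)
open import Function using (_∘_)
open import Level using (0ℓ)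
open import Relation.Binary.PropositionalEquality using (_≡_; refl; sym; cong; cong₂; subst)
open import Relation.Nullary using (¬_; Dec; yes; no; does; contradiction; ¬?; _×-dec_)
open import Relation.Unary using (Pred; Decidable)

------------------------------------------------------------------------
-- Partitions, given by the list of their nonzero terms

record Partition : Set where
  constructor mkPartition
  field
    parts      : List ℕ
    decreasing : Linked _≥_ parts
    positive   : All (0 <_) parts

open Partition public

partition-≡ : ∀ {α β} → parts α ≡ parts β → α ≡ β
partition-≡ {mkPartition l d p} {mkPartition .l d′ p′} refl =
  cong₂ (mkPartition l) (Linked.irrelevant ≤-irrelevant d d′) (All.irrelevant <-irrelevant p p′)

weight : Partition → ℕ
weight α = sum (parts α)

head₀ : List ℕ → ℕ
head₀ []      = 0
head₀ (a ∷ _) = a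

largest : Partition → ℕ
largest α = head₀ (parts α)

multiplicity : Partition → ℕ
multiplicity α = length (filter (_≟ largest α) (parts α))

SuperStrict : Partition → Set
SuperStrict α = AllPairs (λ a b → 2 ≤ ∣ a - b ∣) (parts α)

------------------------------------------------------------------------
-- Containment

deleteRows : (rows : List ℕ) → Subset (length rows) → List ℕ
deleteRows []         []            = []
deleteRows (a ∷ rows) (inside  ∷ R) = deleteRows rows R
deleteRows (a ∷ rows) (outside ∷ R) = a ∷ deleteRows rows R

-- The number of boxes left in a row of a boxes once the columns in C are deleted.
deleteColumns : ∀ {w} → Subset w → ℕ → ℕ
deleteColumns []            a       = 0
deleteColumns (_       ∷ C) zero    = 0
deleteColumns (inside  ∷ C) (suc a) = deleteColumns C a
deleteColumns (outside ∷ C) (suc a) = suc (deleteColumns C a)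

-- Row lengths of the justified remainder; emptied rows disappear.
remainder : (α : Partition) → Subset (length (parts α)) → Subset (largest α) → List ℕ
remainder α R C = filter (0 <?_) (map (deleteColumns C) (deleteRows (parts α) R))

Contains : Partition → Partition → Set
Contains α μ = ∃ λ R → ∃ λ C → remainder α R C ≡ parts μ

Avoids : Partition → Partition → Set
Avoids α μ = ¬ Contains α μ

contains? : ∀ α μ → Dec (Contains α μ)
contains? α μ = anySubset? λ R → anySubset? λ C → ≡-dec _≟_ (remainder α R C) (parts μ)

avoids? : ∀ α μ → Dec (Avoids α μ)
avoids? α μ = ¬? (contains? α μ)

PositiveAv : Partition → Pred Partition 0ℓ
PositiveAv μ α = 0 < weight α × Avoids α μ

positiveAv? : ∀ μ → Decidable (PositiveAv μ)
positiveAv? μ α = 0 <? weight α ×-dec avoids? α μ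

𝒬 : Partition → Partition → Pred Partition 0ℓ
𝒬 τ μ α = 0 < weight α × Contains α τ × Avoids α μ

𝒬? : ∀ τ μ → Decidable (𝒬 τ μ)
𝒬? τ μ α = 0 <? weight α ×-dec contains? α τ ×-dec avoids? α μ

------------------------------------------------------------------------
-- Enumeration of the partitions of n

-- Decreasing lists of at most ℓ positive parts, each at most w.
box : (w ℓ : ℕ) → List (List ℕ)
box zero    ℓ       = [] ∷ []
box (suc w) zero    = [] ∷ []
box (suc w) (suc ℓ) = box w (suc ℓ) ++ map (suc w ∷_) (box (suc w) ℓ)

IsBoxed : ℕ → List ℕ → Set
IsBoxed w l = Linked _≥_ l × All (0 <_) l × All (_≤ w) l

private
  cons-linked : ∀ {w l} → All (_≤ w) l → Linked _≥_ l → Linked _≥_ (w ∷ l)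
  cons-linked []      []       = [-]
  cons-linked (p ∷ _) [-]      = p ∷ [-]
  cons-linked (p ∷ _) (q ∷ qs) = p ∷ q ∷ qs

box-sound : ∀ w ℓ → All (IsBoxed w) (box w ℓ)
box-sound zero    ℓ       = ([] , [] , []) ∷ []
box-sound (suc w) zero    = ([] , [] , []) ∷ []
box-sound (suc w) (suc ℓ) = Allₚ.++⁺
  (All.map (λ { (d , p , b) → d , p , All.map m≤n⇒m≤1+n b }) (box-sound w (suc ℓ)))
  (Allₚ.map⁺ (All.map (λ { (d , p , b) → cons-linked b d , s≤s z≤n ∷ p , ≤-refl ∷ b }) (box-sound (suc w) ℓ)))

box-complete : ∀ w ℓ l → IsBoxed w l → length l ≤ ℓ → l ∈ box w ℓ
box-complete zero    ℓ       []      _                       _  = here refl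
box-complete zero    ℓ       (a ∷ l) (_ , p ∷ _ , b ∷ _)     _  = contradiction (≤-trans p b) λ ()
box-complete (suc w) zero    []      _                       _  = here refl
box-complete (suc w) (suc ℓ) []      _                       _  =
  ∈-++⁺ˡ (box-complete w (suc ℓ) [] ([] , [] , []) z≤n)
box-complete (suc w) (suc ℓ) (a ∷ l) (d , p ∷ ps , b ∷ bs) le with a ≟ suc w
... | yes refl = ∈-++⁺ʳ (box w (suc ℓ))
                   (∈-map⁺ (suc w ∷_) (box-complete (suc w) ℓ l (Linked.tail d , ps , bs) (s≤s⁻¹ le)))
... | no a≢    = ∈-++⁺ˡ (box-complete w (suc ℓ) (a ∷ l) (d , p ∷ ps , Linked⇒All ge a≤w d) le)
  where
  a≤w : a ≤ w
  a≤w = s≤s⁻¹ (≤∧≢⇒< b a≢)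
  ge : ∀ {i j k} → j ≤ i → k ≤ j → k ≤ i
  ge p q = ≤-trans q p

box-unique : ∀ w ℓ → Unique (box w ℓ)
box-unique zero    ℓ       = [] ∷ []
box-unique (suc w) zero    = [] ∷ []
box-unique (suc w) (suc ℓ) = Uniqueₚ.++⁺
  (box-unique w (suc ℓ)) (Uniqueₚ.map⁺ ∷-injectiveʳ (box-unique (suc w) ℓ)) disjoint
  where
  disjoint : ∀ {l} → ¬ (l ∈ box w (suc ℓ) × l ∈ map (suc w ∷_) (box (suc w) ℓ))
  disjoint (i , j) with ∈-map⁻ (suc w ∷_) j
  ... | _ , _ , refl with All.lookup (box-sound w (suc ℓ)) i
  ... | _ , _ , b ∷ _ = 1+n≰n b

toPartition : ∀ {w l} → IsBoxed w l → Partition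
toPartition {l = l} (d , p , _) = mkPartition l d p

boxed : (w ℓ : ℕ) → List Partition
boxed w ℓ = All.reduce toPartition (box-sound w ℓ)

partitions : ℕ → List Partition
partitions n = filter (λ α → weight α ≟ n) (boxed n n)

private
  map-parts : ∀ {w ls} (bs : All (IsBoxed w) ls) → map parts (All.reduce toPartition bs) ≡ ls
  map-parts []       = refl
  map-parts (b ∷ bs) = cong (_ ∷_) (map-parts bs)

  parts≤sum : ∀ l → All (_≤ sum l) l
  parts≤sum []      = []
  parts≤sum (a ∷ l) = m≤m+n a _ ∷ All.map (λ q → ≤-trans q (m≤n+m _ a)) (parts≤sum l)

  length≤sum : ∀ {l} → All (0 <_) l → length l ≤ sum l
  length≤sum []       = z≤n
  length≤sum (p ∷ ps) = +-mono-≤ p (length≤sum ps)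

∈-partitions⁺ : ∀ α → α ∈ partitions (weight α)
∈-partitions⁺ α = ∈-filter⁺ (λ β → weight β ≟ weight α) α∈ refl
  where
  n = weight α
  l∈ : parts α ∈ map parts (boxed n n)
  l∈ = subst (parts α ∈_) (sym (map-parts (box-sound n n)))
         (box-complete n n (parts α) (decreasing α , positive α , parts≤sum (parts α)) (length≤sum (positive α)))
  α∈ : α ∈ boxed n n
  α∈ with ∈-map⁻ parts l∈
  ... | β , β∈ , eq = subst (_∈ boxed n n) (sym (partition-≡ eq)) β∈

∈-partitions⁻ : ∀ {α n} → α ∈ partitions n → weight α ≡ n
∈-partitions⁻ {n = n} = proj₂ ∘ ∈-filter⁻ (λ β → weight β ≟ n) {xs = boxed n n}

partitions-unique : ∀ n → Unique (partitions n)
partitions-unique n = Uniqueₚ.filter⁺ (λ β → weight β ≟ n)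
  (Uniqueₚ.map⁻ (subst Unique (sym (map-parts (box-sound n n))) (box-unique n n)))

Av : ℕ → Partition → List Partition
Av n μ = filter (λ α → avoids? α μ) (partitions n)

------------------------------------------------------------------------
-- Polynomials in t, by coefficient lists; trailing zeros are allowed, so
-- polynomials are compared through coeff.

Poly : Set
Poly = List ℤ

coeff : Poly → ℕ → ℤ
coeff []      _       = 0ℤ
coeff (a ∷ p) zero    = a
coeff (a ∷ p) (suc m) = coeff p m

const : ℤ → Poly
const c = c ∷ []

t^_ : ℕ → Poly
t^ zero  = const 1ℤ
t^ suc m = 0ℤ ∷ t^ m

infixl 6 _+ᴾ_
infixl 7 _*ᴾ_ _·ᴾ_

_+ᴾ_ : Poly → Poly → Poly
[]      +ᴾ q       = q
p@(_ ∷ _) +ᴾ []    = p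
(a ∷ p) +ᴾ (b ∷ q) = (a +ℤ b) ∷ (p +ᴾ q)

-ᴾ_ : Poly → Poly
-ᴾ p = map -ℤ_ p

_·ᴾ_ : ℤ → Poly → Poly
c ·ᴾ p = map (c *ℤ_) p

_*ᴾ_ : Poly → Poly → Poly
[]      *ᴾ q = []
(a ∷ p) *ᴾ q = a ·ᴾ q +ᴾ (0ℤ ∷ p *ᴾ q)

∑ : List Poly → Poly
∑ = foldr _+ᴾ_ []

------------------------------------------------------------------------
-- Series in ℤ[t][[z]].  Each power of z carries a polynomial in t, which is
-- what makes the specialization t = 1 meaningful.

Series : Set
Series = ℕ → Poly

infix 4 _≈_
infixl 6 _⊕_ _⊖_
infixl 7 _⊛_

_≈_ : Series → Series → Set
G ≈ H = ∀ n m → coeff (G n) m ≡ coeff (H n) m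

_⊕_ _⊖_ _⊛_ : Series → Series → Series
(G ⊕ H) n = G n +ᴾ H n
(G ⊖ H) n = G n +ᴾ (-ᴾ H n)
(G ⊛ H) n = ∑ (map (λ i → G i *ᴾ H (n ∸ i)) (upTo (suc n)))

z^_t^_ : ℕ → ℕ → Series
(z^ a t^ b) n = if does (n ≟ a) then t^ b else []

𝟙 : Series
𝟙 = z^ 0 t^ 0

-- 1/(1 - zᵃtᵇ) = ∑ₖ zᵃᵏtᵇᵏ, for a ≥ 1; the terms with k > n do not contribute to zⁿ.
1/1-z^_t^_ : ℕ → ℕ → Series
(1/1-z^ a t^ b) n = ∑ (map (λ k → (z^ (a * k) t^ (b * k)) n) (upTo (suc n)))

-- G(z,1)
at-t=1 : Series → Series
at-t=1 G n = const (foldr _+ℤ_ 0ℤ (G n))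

-- G(z,0)
at-t=0 : Series → Series
at-t=0 G n = const (coeff (G n) 0)

-- G(z,zt): the coefficient of zⁿtᵐ is that of zⁿ⁻ᵐtᵐ in G.
at-t=zt : Series → Series
at-t=zt G n = map (λ m → coeff (G (n ∸ m)) m) (upTo (suc n))

-- 1, …, n
infix 8 1⋯_
1⋯_ : ℕ → List ℕ
1⋯ n = map suc (upTo n)

------------------------------------------------------------------------
-- The operators

data Op : Set where
  𝓔 𝓝 : Op

applyE : Series → Series
applyE G = (at-t=1 G ⊖ (z^ 1 t^ 1) ⊛ at-t=zt G) ⊛ (1/1-z^ 1 t^ 1)

-- 1/(1 - zᵐ) · (1 - (tz)ᵐ)/(1 - tz) · zⁿ
termN : (n m : ℕ) → Series
termN n m = (1/1-z^ m t^ 0) ⊛ ((𝟙 ⊖ (z^ m t^ m)) ⊛ (1/1-z^ 1 t^ 1)) ⊛ (z^ n t^ 0)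

-- At z^N only the terms with n ≤ N and m < length (G n) can be nonzero.
applyN : Series → Series
applyN G = at-t=0 G ⊕ λ N →
  ∑ (map (λ n → ∑ (map (λ m → coeff (G n) m ·ᴾ termN n m N) (1⋯ length (G n)))) (1⋯ N))

apply : Op → Series → Series
apply 𝓔 = applyE
apply 𝓝 = applyN

applyAll : List Op → Series → Series
applyAll Θ G = foldl (λ H o → apply o H) G Θ

------------------------------------------------------------------------
-- The southeast border and Θ

data Step : Set where
  east north : Step

borderOf : List ℕ → List Step
borderOf []      = []
borderOf (a ∷ l) = borderOf l ++ replicate (a ∸ head₀ l) east ++ (north ∷ [])

border : Partition → List Step
border μ = borderOf (parts μ)

-- The last clause is not reached from the border of a super-strict partition
-- of weight at least 2.
readSteps : List Step → List Op
readSteps (east ∷ north ∷ []) = []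
readSteps (east ∷ s)          = 𝓔 ∷ readSteps s
readSteps (north ∷ east ∷ s)  = 𝓝 ∷ readSteps s
readSteps _                   = []

dropInitialEast : List Step → List Step
dropInitialEast (east ∷ s) = s
dropInitialEast s          = s

Θ : Partition → List Op
Θ μ = readSteps (dropInitialEast (border μ))

------------------------------------------------------------------------
-- Generating functions

F[_] : {S : Pred Partition 0ℓ} → Decidable S → Series
F[ S? ] n = ∑ (map (λ α → t^ multiplicity α) (filter S? (partitions n)))

F : Partition → Series
F μ = F[ positiveAv? μ ]

F₂ : Partition → Partition → Series
F₂ τ μ = F[ 𝒬? τ μ ]

-- ∑_{n≥1} |Avₙ(μ)| zⁿ
avSeries : Partition → Series
avSeries μ zero    = []
avSeries μ (suc n) = const (pos (length (Av (suc n) μ)))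

------------------------------------------------------------------------
-- τ = (μ₁ - 1, μ₂, μ₃, …)

decrementFirst : (μ : Partition) → SuperStrict μ → 2 ≤ weight μ → Partition
decrementFirst (mkPartition [] _ _) _ ()
decrementFirst (mkPartition (a ∷ []) _ _) _ w =
  mkPartition (a ∸ 1 ∷ []) [-] (∸-monoˡ-≤ 1 (subst (2 ≤_) (+-identityʳ a) w) ∷ [])
decrementFirst (mkPartition (a ∷ b ∷ l) (b≤a ∷ d) (_ ∷ p ∷ ps)) ((gap ∷ _) ∷ _) _ =
  mkPartition (a ∸ 1 ∷ b ∷ l) (<⇒≤ b<a-1 ∷ d) (≤-trans p (<⇒≤ b<a-1) ∷ p ∷ ps)
  where
  2+b≤a : 2 + b ≤ a
  2+b≤a = m≤o∸n⇒m+n≤o 2 b≤a (subst (2 ≤_) (m≤n⇒∣n-m∣≡n∸m b≤a) gap)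
  b<a-1 : b < a ∸ 1
  b<a-1 = ∸-monoˡ-≤ 1 2+b≤a

infixl 6 _+ˡ_
_+ˡ_ : List ℕ → List ℕ → List ℕ
[]      +ˡ bs       = bs
as@(_ ∷ _) +ˡ []    = as
(a ∷ as) +ˡ (b ∷ bs) = (a + b) ∷ (as +ˡ bs)

μ≡τ+1 : ∀ μ ss w → parts μ ≡ parts (decrementFirst μ ss w) +ˡ (1 ∷ [])
μ≡τ+1 (mkPartition [] _ _) _ ()
μ≡τ+1 (mkPartition (suc a ∷ []) _ _) _ _ = cong (_∷ []) (+-comm 1 a)
μ≡τ+1 (mkPartition (zero ∷ []) _ (() ∷ _)) _ _
μ≡τ+1 (mkPartition (suc a ∷ b ∷ l) (_ ∷ _) (_ ∷ _ ∷ _)) ((_ ∷ _) ∷ _) _ = cong (_∷ b ∷ l) (+-comm 1 a)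
μ≡τ+1 (mkPartition (zero ∷ b ∷ l) _ (() ∷ _)) _ _

-- A polynomial or series is determined by its pairings with test functions, and
-- under the pairing both operators become transposes acting on tests.  The
-- transpose of 𝓔 sums over the height k ≤ m of a new column to the right of one of
-- height m; the transpose of 𝓝 also inserts any number of columns of height m and
-- then requires k < m.  Transposing Θ_μ thus counts the lists of column heights on
-- which an automaton, driven by Θ_μ and reading columns greedily from the left,
-- stops in a prescribed state.  The automaton decides containment: it runs out of
-- columns early iff the board avoids τ, and has columns left over iff the board
-- contains μ; otherwise the last column read is the last column of the board, whose
-- height is the multiplicity of the largest part.

module Submission where

open import Defs
open import Data.Bool using (if_then_else_; true; false)
open import Data.Fin.Subset using (Subset; inside; outside)
open import Data.Integer using (ℤ; 0ℤ; 1ℤ) renaming (+_ to pos; -_ to -ℤ_; _+_ to _+ℤ_; _*_ to _*ℤ_)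
import Data.Integer.Properties as ℤₚ
open import Data.Integer.Tactic.RingSolver using (solve-∀)
open import Algebra.Properties.CommutativeSemigroup ℤₚ.+-commutativeSemigroup using (interchange; x∙yz≈y∙xz)
open import Data.List using (List; []; _∷_; _++_; applyUpTo; drop; filter; foldr; length; map; replicate; take)
open import Data.List.Membership.Propositional using (_∈_)
open import Data.List.Membership.Propositional.Properties using (∈-map⁺; ∈-map⁻)
open import Data.List.Membership.Propositional.Properties.WithK using (unique∧set⇒bag)
open import Data.List.Properties using (++-identityʳ; filter-all; length-++; length-map; length-replicate; map-++; map-cong-local; map-id-local; map-replicate; map-∘; take-map; ∷-injectiveʳ; ∷-injectiveˡ)
open import Data.List.Relation.Binary.BagAndSetEquality using (∼bag⇒↭)
open import Data.List.Relation.Binary.Permutation.Propositional as Perm using (_↭_)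
open import Data.List.Relation.Binary.Sublist.Propositional using (_⊆_; []; _∷_; _∷ʳ_; minimum; ⊆-trans)
open import Data.List.Relation.Binary.Sublist.Propositional.Properties using (++⁺; ++⁺ʳ; All-resp-⊆; map⁺; take-⊆)
open import Data.List.Relation.Unary.All as All using (All; []; _∷_)
import Data.List.Relation.Unary.All.Properties as Allₚ
open import Data.List.Relation.Unary.AllPairs using (AllPairs; []; _∷_)
open import Data.List.Relation.Unary.Any using (here; there)
open import Data.List.Relation.Unary.Linked as Linked using (Linked; []; [-]; _∷_)
import Data.List.Relation.Unary.Unique.Propositional.Properties as Uniqueₚ
open import Data.Nat using (ℕ; zero; suc; pred; _+_; _*_; _∸_; _≤_; _<_; _≥_; z≤n; s≤s; s≤s⁻¹; _≟_; _<?_; ∣_-_∣; >-nonZero)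
open import Data.Nat.ListAction using (sum)
open import Data.Nat.ListAction.Properties using (sum-++)
import Data.Nat.Properties as ℕₚ
open import Data.Product using (∃; _×_; _,_; proj₁; proj₂)
open import Data.Sum using (inj₁; inj₂)
open import Data.Vec using ([]; _∷_)
open import Function using (_∘_; id; _⇔_; mk⇔; Equivalence)
open import Function.Construct.Composition using (_⇔-∘_)
open import Function.Construct.Identity using (⇔-id)
open import Level using (0ℓ)
open import Relation.Binary.PropositionalEquality
open import Relation.Nullary using (¬_; Dec; yes; no; does; contradiction; _×-dec_)
open import Relation.Nullary.Decidable using (dec-true; dec-false)
open import Relation.Unary using (Pred; Decidable)

-- Applied to `t^m`, 𝓔 gives (1 - (zt)^(m+1))/(1 - zt), a finite geometric sum of (zt)^k over k ≤ m,
-- and 𝓝 gives the sum over k < m divided by 1 - z^m. So z counts the boxes of the columns, t marks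
-- the height of the latest one, and zt/(1 - zt) chooses the first column. A missing column has
-- height 0 and leaves t^0; hence the τ-avoiders enter through F_τ(z,1), while the other partitions
-- keep their multiplicity. Pairings are used because the defining formulas divide by series, cut
-- sums at bounds that depend on the coefficient, and give coefficient lists only up to trailing
-- zeros. A test ignores all of this, and 1/(1 - x) becomes a recursion on the remaining weight, the
-- same one that the automaton obeys. Greedy reading rests on an exchange: the leftmost column of
-- the pattern may be matched with the next column of the board for 𝓔, and for 𝓝 with the next one
-- shorter than the last column read, which is where a row of the board ends.

Test : Set
Test = ℕ → ℕ → ℤ

-- Finite sums of integers

sumTo : ℕ → (ℕ → ℤ) → ℤ
sumTo zero    f = 0ℤ
sumTo (suc k) f = f 0 +ℤ sumTo k (f ∘ suc)

sumTo-cong : ∀ k {f g : ℕ → ℤ} → f ≗ g → sumTo k f ≡ sumTo k g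
sumTo-cong zero    e = refl
sumTo-cong (suc k) e = cong₂ _+ℤ_ (e 0) (sumTo-cong k (e ∘ suc))

sumTo-+ : ∀ k f g → sumTo k (λ i → f i +ℤ g i) ≡ sumTo k f +ℤ sumTo k g
sumTo-+ zero    f g = refl
sumTo-+ (suc k) f g rewrite sumTo-+ k (f ∘ suc) (g ∘ suc) = interchange (f 0) (g 0) _ _

sumTo-zero : ∀ k {f : ℕ → ℤ} → (∀ i → f i ≡ 0ℤ) → sumTo k f ≡ 0ℤ
sumTo-zero zero    e = refl
sumTo-zero (suc k) e = cong₂ _+ℤ_ (e 0) (sumTo-zero k (e ∘ suc))

sumTo-extend : ∀ {h k} f → h ≤ k → (∀ i → h ≤ i → f i ≡ 0ℤ) → sumTo h f ≡ sumTo k f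
sumTo-extend {k = k} f z≤n     e = sym (sumTo-zero k (λ i → e i z≤n))
sumTo-extend         f (s≤s l) e = cong (f 0 +ℤ_) (sumTo-extend (f ∘ suc) l (λ i q → e (suc i) (s≤s q)))

-- Pairing of polynomials and series with test functions

pairᴾ : Poly → (ℕ → ℤ) → ℤ
pairᴾ []      f = 0ℤ
pairᴾ (a ∷ p) f = a *ℤ f 0 +ℤ pairᴾ p (f ∘ suc)

pairᴾ-cong : ∀ p {f g : ℕ → ℤ} → f ≗ g → pairᴾ p f ≡ pairᴾ p g
pairᴾ-cong []      e = refl
pairᴾ-cong (a ∷ p) e = cong₂ (λ x y → a *ℤ x +ℤ y) (e 0) (pairᴾ-cong p (e ∘ suc))

pairᴾ-+ᴾ : ∀ p q f → pairᴾ (p +ᴾ q) f ≡ pairᴾ p f +ℤ pairᴾ q f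
pairᴾ-+ᴾ []      q       f = sym (ℤₚ.+-identityˡ _)
pairᴾ-+ᴾ (a ∷ p) []      f = sym (ℤₚ.+-identityʳ _)
pairᴾ-+ᴾ (a ∷ p) (b ∷ q) f rewrite pairᴾ-+ᴾ p q (f ∘ suc) = lemma a b (f 0) _ _
  where
  lemma : ∀ a b x y z → (a +ℤ b) *ℤ x +ℤ (y +ℤ z) ≡ (a *ℤ x +ℤ y) +ℤ (b *ℤ x +ℤ z)
  lemma = solve-∀

pairᴾ-·ᴾ : ∀ c p f → pairᴾ (c ·ᴾ p) f ≡ c *ℤ pairᴾ p f
pairᴾ-·ᴾ c []      f = sym (ℤₚ.*-zeroʳ c)
pairᴾ-·ᴾ c (a ∷ p) f rewrite pairᴾ-·ᴾ c p (f ∘ suc) = lemma c a (f 0) _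
  where
  lemma : ∀ c a x y → (c *ℤ a) *ℤ x +ℤ c *ℤ y ≡ c *ℤ (a *ℤ x +ℤ y)
  lemma = solve-∀

pairᴾ-neg : ∀ p f → pairᴾ (-ᴾ p) f ≡ -ℤ pairᴾ p f
pairᴾ-neg []      f = refl
pairᴾ-neg (a ∷ p) f rewrite pairᴾ-neg p (f ∘ suc) = lemma a (f 0) _
  where
  lemma : ∀ a x y → (-ℤ a) *ℤ x +ℤ (-ℤ y) ≡ -ℤ (a *ℤ x +ℤ y)
  lemma = solve-∀

pairᴾ-+ : ∀ p f g → pairᴾ p (λ m → f m +ℤ g m) ≡ pairᴾ p f +ℤ pairᴾ p g
pairᴾ-+ []      f g = refl
pairᴾ-+ (a ∷ p) f g rewrite pairᴾ-+ p (f ∘ suc) (g ∘ suc) = lemma a (f 0) (g 0) _ _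
  where
  lemma : ∀ a x y u v → a *ℤ (x +ℤ y) +ℤ (u +ℤ v) ≡ (a *ℤ x +ℤ u) +ℤ (a *ℤ y +ℤ v)
  lemma = solve-∀

pairᴾ-const : ∀ p c → pairᴾ p (λ _ → c) ≡ foldr _+ℤ_ 0ℤ p *ℤ c
pairᴾ-const []      c = refl
pairᴾ-const (a ∷ p) c rewrite pairᴾ-const p c = sym (ℤₚ.*-distribʳ-+ c a _)

pairᴾ-zero : ∀ p {f : ℕ → ℤ} → (∀ m → f m ≡ 0ℤ) → pairᴾ p f ≡ 0ℤ
pairᴾ-zero p e = trans (pairᴾ-cong p e) (trans (pairᴾ-const p 0ℤ) (ℤₚ.*-zeroʳ (foldr _+ℤ_ 0ℤ p)))

pairᴾ-*ᴾ : ∀ p q f → pairᴾ (p *ᴾ q) f ≡ pairᴾ p (λ i → pairᴾ q (λ j → f (i + j)))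
pairᴾ-*ᴾ []      q f = refl
pairᴾ-*ᴾ (a ∷ p) q f = begin
  pairᴾ (a ·ᴾ q +ᴾ (0ℤ ∷ p *ᴾ q)) f                            ≡⟨ pairᴾ-+ᴾ (a ·ᴾ q) _ f ⟩
  pairᴾ (a ·ᴾ q) f +ℤ (0ℤ *ℤ f 0 +ℤ pairᴾ (p *ᴾ q) (f ∘ suc))  ≡⟨ cong₂ _+ℤ_ (pairᴾ-·ᴾ a q f) (ℤₚ.+-identityˡ _) ⟩
  a *ℤ pairᴾ q f +ℤ pairᴾ (p *ᴾ q) (f ∘ suc)                   ≡⟨ cong (a *ℤ pairᴾ q f +ℤ_) (pairᴾ-*ᴾ p q (f ∘ suc)) ⟩
  pairᴾ (a ∷ p) (λ i → pairᴾ q (λ j → f (i + j)))              ∎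
  where open ≡-Reasoning

pairᴾ-t^ : ∀ m f → pairᴾ (t^ m) f ≡ f m
pairᴾ-t^ zero    f = trans (ℤₚ.+-identityʳ _) (ℤₚ.*-identityˡ (f 0))
pairᴾ-t^ (suc m) f = trans (ℤₚ.+-identityˡ _) (pairᴾ-t^ m (f ∘ suc))

pairᴾ-∑ : ∀ {A : Set} (h : A → Poly) k (g : ℕ → A) f →
         pairᴾ (∑ (map h (applyUpTo g k))) f ≡ sumTo k (λ i → pairᴾ (h (g i)) f)
pairᴾ-∑ h zero    g f = refl
pairᴾ-∑ h (suc k) g f = trans (pairᴾ-+ᴾ (h (g 0)) _ f) (cong (pairᴾ (h (g 0)) f +ℤ_) (pairᴾ-∑ h k (g ∘ suc) f))

pairᴾ-∑₁ : ∀ (h : ℕ → Poly) k (g : ℕ → ℕ) f →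
          pairᴾ (∑ (map h (map suc (applyUpTo g k)))) f ≡ sumTo k (λ i → pairᴾ (h (suc (g i))) f)
pairᴾ-∑₁ h zero    g f = refl
pairᴾ-∑₁ h (suc k) g f = trans (pairᴾ-+ᴾ (h (suc (g 0))) _ f) (cong (pairᴾ (h (suc (g 0))) f +ℤ_) (pairᴾ-∑₁ h k (g ∘ suc) f))

pairᴾ≡sumTo : ∀ p f → pairᴾ p f ≡ sumTo (length p) (λ m → coeff p m *ℤ f m)
pairᴾ≡sumTo []      f = refl
pairᴾ≡sumTo (a ∷ p) f = cong (a *ℤ f 0 +ℤ_) (pairᴾ≡sumTo p (f ∘ suc))

coeff-beyond : ∀ p m → length p ≤ m → coeff p m ≡ 0ℤ
coeff-beyond []      m       _       = refl
coeff-beyond (a ∷ p) (suc m) (s≤s l) = coeff-beyond p m l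

-- Recursive rather than through `_≟_`, so that a common successor cancels by computation, as a
-- `shift` requires.
δ : ℕ → ℕ → ℤ
δ zero    zero    = 1ℤ
δ zero    (suc n) = 0ℤ
δ (suc m) zero    = 0ℤ
δ (suc m) (suc n) = δ m n

pairᴾ-coeff : ∀ p m → pairᴾ p (λ i → δ i m) ≡ coeff p m
pairᴾ-coeff []      m       = refl
pairᴾ-coeff (a ∷ p) zero    = trans (cong₂ _+ℤ_ (ℤₚ.*-identityʳ a) (pairᴾ-zero p (λ _ → refl))) (ℤₚ.+-identityʳ a)
pairᴾ-coeff (a ∷ p) (suc m) = trans (cong (_+ℤ pairᴾ p (λ i → δ i m)) (ℤₚ.*-zeroʳ a)) (trans (ℤₚ.+-identityˡ _) (pairᴾ-coeff p m))

-- Trailing zeros contribute nothing to a pairing; this carries `_≈_` over to the specialization t =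
-- 1.
pairᴾ-coeff-cong : ∀ p q f → (∀ m → coeff p m ≡ coeff q m) → pairᴾ p f ≡ pairᴾ q f
pairᴾ-coeff-cong []      []      f e = refl
pairᴾ-coeff-cong []      (b ∷ q) f e rewrite sym (e 0) =
  trans (pairᴾ-coeff-cong [] q (f ∘ suc) (e ∘ suc)) (sym (ℤₚ.+-identityˡ _))
pairᴾ-coeff-cong (a ∷ p) []      f e rewrite e 0 =
  trans (ℤₚ.+-identityˡ _) (pairᴾ-coeff-cong p [] (f ∘ suc) (e ∘ suc))
pairᴾ-coeff-cong (a ∷ p) (b ∷ q) f e =
  cong₂ (λ x y → x *ℤ f 0 +ℤ y) (e 0) (pairᴾ-coeff-cong p q (f ∘ suc) (e ∘ suc))

-- r ↦ φ (r - a), and 0 for r < a.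
shift : ℕ → (ℕ → ℤ) → ℕ → ℤ
shift zero    φ r       = φ r
shift (suc a) φ zero    = 0ℤ
shift (suc a) φ (suc r) = shift a φ r

shift-cong : ∀ a {φ ψ : ℕ → ℤ} → φ ≗ ψ → shift a φ ≗ shift a ψ
shift-cong zero    e r       = e r
shift-cong (suc a) e zero    = refl
shift-cong (suc a) e (suc r) = shift-cong a e r

shift-cong-≤ : ∀ a {φ ψ : ℕ → ℤ} r → (∀ s → a + s ≡ r → φ s ≡ ψ s) → shift a φ r ≡ shift a ψ r
shift-cong-≤ zero    r       e = e r refl
shift-cong-≤ (suc a) zero    e = refl
shift-cong-≤ (suc a) (suc r) e = shift-cong-≤ a r (λ s q → e s (cong suc q))

shift-+ : ∀ a φ ψ r → shift a (λ s → φ s +ℤ ψ s) r ≡ shift a φ r +ℤ shift a ψ r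
shift-+ zero    φ ψ r       = refl
shift-+ (suc a) φ ψ zero    = refl
shift-+ (suc a) φ ψ (suc r) = shift-+ a φ ψ r

shift-shift : ∀ a b φ → shift a (shift b φ) ≗ shift (a + b) φ
shift-shift zero    b φ r       = refl
shift-shift (suc a) b φ zero    = refl
shift-shift (suc a) b φ (suc r) = shift-shift a b φ r

shift-zero : ∀ a N → shift a (λ _ → 0ℤ) N ≡ 0ℤ
shift-zero zero    N       = refl
shift-zero (suc a) zero    = refl
shift-zero (suc a) (suc N) = shift-zero a N

shift-small : ∀ a φ {r} → r < a → shift a φ r ≡ 0ℤ
shift-small (suc a) φ {zero}  _       = refl
shift-small (suc a) φ {suc r} (s≤s l) = shift-small a φ l

shift-sumTo : ∀ a k (f : ℕ → ℕ → ℤ) r → shift a (λ s → sumTo k (λ i → f i s)) r ≡ sumTo k (λ i → shift a (f i) r)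
shift-sumTo zero    k f r       = refl
shift-sumTo (suc a) k f zero    = sym (sumTo-zero k (λ _ → refl))
shift-sumTo (suc a) k f (suc r) = shift-sumTo a k f r

-- ∑_{n ≤ N} pairᴾ (G n) (φ (N - n)): the first argument of a test is the weight
-- still to be distributed, so that no subtraction is needed.
pairˢ : Series → Test → ℕ → ℤ
pairˢ G φ zero    = pairᴾ (G 0) (φ 0)
pairˢ G φ (suc N) = pairᴾ (G 0) (φ (suc N)) +ℤ pairˢ (G ∘ suc) φ N

infix 4 _≋_
_≋_ : Test → Test → Set
φ ≋ ψ = ∀ r → φ r ≗ ψ r

pairˢ-cong : ∀ G {φ ψ} → φ ≋ ψ → pairˢ G φ ≗ pairˢ G ψ
pairˢ-cong G e zero    = pairᴾ-cong (G 0) (e 0)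
pairˢ-cong G e (suc N) = cong₂ _+ℤ_ (pairᴾ-cong (G 0) (e (suc N))) (pairˢ-cong (G ∘ suc) e N)

-- Agreement is asked of pairings and not of lists, because rearranging a product may change
-- trailing zeros.
pairˢ-pairs : ∀ {G H} φ N → (∀ n f → pairᴾ (G n) f ≡ pairᴾ (H n) f) → pairˢ G φ N ≡ pairˢ H φ N
pairˢ-pairs φ zero    e = e 0 _
pairˢ-pairs φ (suc N) e = cong₂ _+ℤ_ (e 0 _) (pairˢ-pairs φ N (e ∘ suc))

pairˢ-⊕ : ∀ G H φ N → pairˢ (G ⊕ H) φ N ≡ pairˢ G φ N +ℤ pairˢ H φ N
pairˢ-⊕ G H φ zero    = pairᴾ-+ᴾ (G 0) (H 0) _
pairˢ-⊕ G H φ (suc N) rewrite pairᴾ-+ᴾ (G 0) (H 0) (φ (suc N)) | pairˢ-⊕ (G ∘ suc) (H ∘ suc) φ N =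
  interchange (pairᴾ (G 0) (φ (suc N))) _ _ _

pairˢ-⊖ : ∀ G H φ N → pairˢ (G ⊖ H) φ N ≡ pairˢ G φ N +ℤ -ℤ pairˢ H φ N
pairˢ-⊖ G H φ zero    = trans (pairᴾ-+ᴾ (G 0) (-ᴾ H 0) (φ 0)) (cong (pairᴾ (G 0) (φ 0) +ℤ_) (pairᴾ-neg (H 0) (φ 0)))
pairˢ-⊖ G H φ (suc N) rewrite pairᴾ-+ᴾ (G 0) (-ᴾ H 0) (φ (suc N)) | pairᴾ-neg (H 0) (φ (suc N))
                         | pairˢ-⊖ (G ∘ suc) (H ∘ suc) φ N = lemma (pairᴾ (G 0) (φ (suc N))) _ _ _
  where
  lemma : ∀ a b c d → (a +ℤ -ℤ b) +ℤ (c +ℤ -ℤ d) ≡ (a +ℤ c) +ℤ -ℤ (b +ℤ d)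
  lemma = solve-∀

pairˢ-+ : ∀ G φ ψ N → pairˢ G (λ r m → φ r m +ℤ ψ r m) N ≡ pairˢ G φ N +ℤ pairˢ G ψ N
pairˢ-+ G φ ψ zero    = pairᴾ-+ (G 0) _ _
pairˢ-+ G φ ψ (suc N) rewrite pairᴾ-+ (G 0) (φ (suc N)) (ψ (suc N)) | pairˢ-+ (G ∘ suc) φ ψ N =
  interchange (pairᴾ (G 0) (φ (suc N))) _ _ _

pairˢ-empty : ∀ φ N → pairˢ (λ _ → []) φ N ≡ 0ℤ
pairˢ-empty φ zero    = refl
pairˢ-empty φ (suc N) = trans (ℤₚ.+-identityˡ _) (pairˢ-empty φ N)

pairˢ-const* : ∀ p H φ N → pairˢ (λ n → p *ᴾ H n) φ N ≡ pairᴾ p (λ a → pairˢ H (λ r b → φ r (a + b)) N)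
pairˢ-const* p H φ zero    = pairᴾ-*ᴾ p (H 0) (φ 0)
pairˢ-const* p H φ (suc N) = trans
  (cong₂ _+ℤ_ (pairᴾ-*ᴾ p (H 0) (φ (suc N))) (pairˢ-const* p (H ∘ suc) φ N))
  (sym (pairᴾ-+ p _ _))

⊛-suc : ∀ G H n f → pairᴾ ((G ⊛ H) (suc n)) f ≡ pairᴾ (G 0 *ᴾ H (suc n)) f +ℤ pairᴾ (((G ∘ suc) ⊛ H) n) f
⊛-suc G H n f = begin
  pairᴾ ((G ⊛ H) (suc n)) f
    ≡⟨ pairᴾ-+ᴾ (G 0 *ᴾ H (suc n)) _ f ⟩
  pairᴾ (G 0 *ᴾ H (suc n)) f +ℤ pairᴾ (∑ (map (λ i → G i *ᴾ H (suc n ∸ i)) (applyUpTo suc (suc n)))) f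
    ≡⟨ cong (pairᴾ (G 0 *ᴾ H (suc n)) f +ℤ_) (trans (pairᴾ-∑ (λ i → G i *ᴾ H (suc n ∸ i)) (suc n) suc f)
                                                   (sym (pairᴾ-∑ (λ i → G (suc i) *ᴾ H (n ∸ i)) (suc n) id f))) ⟩
  pairᴾ (G 0 *ᴾ H (suc n)) f +ℤ pairᴾ (((G ∘ suc) ⊛ H) n) f ∎
  where open ≡-Reasoning

-- Convolution becomes iteration: a term of `G` leaves its remaining weight `r` to `H`, and the
-- exponents of t add up.
pairˢ-⊛ : ∀ G H φ N → pairˢ (G ⊛ H) φ N ≡ pairˢ G (λ r a → pairˢ H (λ s b → φ s (a + b)) r) N
pairˢ-⊛ G H φ zero    = trans (pairᴾ-+ᴾ (G 0 *ᴾ H 0) [] (φ 0)) (trans (ℤₚ.+-identityʳ _) (pairᴾ-*ᴾ (G 0) (H 0) (φ 0)))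
pairˢ-⊛ G H φ (suc N) = begin
  pairᴾ ((G ⊛ H) 0) (φ (suc N)) +ℤ pairˢ ((G ⊛ H) ∘ suc) φ N
    ≡⟨ cong₂ _+ℤ_ (trans (pairᴾ-+ᴾ (G 0 *ᴾ H 0) [] (φ (suc N))) (ℤₚ.+-identityʳ (pairᴾ (G 0 *ᴾ H 0) (φ (suc N)))))
         (trans (pairˢ-pairs φ N (λ n f → trans (⊛-suc G H n f) (sym (pairᴾ-+ᴾ (G 0 *ᴾ H (suc n)) _ f))))
                (pairˢ-⊕ (λ n → G 0 *ᴾ H (suc n)) ((G ∘ suc) ⊛ H) φ N)) ⟩
  pairᴾ (G 0 *ᴾ H 0) (φ (suc N)) +ℤ (pairˢ (λ n → G 0 *ᴾ H (suc n)) φ N +ℤ pairˢ ((G ∘ suc) ⊛ H) φ N)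
    ≡⟨ sym (ℤₚ.+-assoc (pairᴾ (G 0 *ᴾ H 0) (φ (suc N))) _ _) ⟩
  pairˢ (λ n → G 0 *ᴾ H n) φ (suc N) +ℤ pairˢ ((G ∘ suc) ⊛ H) φ N
    ≡⟨ cong₂ _+ℤ_ (pairˢ-const* (G 0) H φ (suc N)) (pairˢ-⊛ (G ∘ suc) H φ N) ⟩
  pairˢ G (λ r a → pairˢ H (λ s b → φ s (a + b)) r) (suc N) ∎
  where open ≡-Reasoning

pairˢ-shift₁ : ∀ G φ N → pairˢ G (λ r m → shift 1 (λ s → φ s m) r) N ≡ shift 1 (pairˢ G φ) N
pairˢ-shift₁ G φ zero          = pairᴾ-zero (G 0) (λ _ → refl)
pairˢ-shift₁ G φ (suc zero)    = trans (cong (pairᴾ (G 0) (φ 0) +ℤ_) (pairˢ-shift₁ (G ∘ suc) φ zero)) (ℤₚ.+-identityʳ _)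
pairˢ-shift₁ G φ (suc (suc N)) = cong (pairᴾ (G 0) (φ (suc N)) +ℤ_) (pairˢ-shift₁ (G ∘ suc) φ (suc N))

pairˢ-shift : ∀ a G φ N → pairˢ G (λ r m → shift a (λ s → φ s m) r) N ≡ shift a (pairˢ G φ) N
pairˢ-shift zero    G φ N = refl
pairˢ-shift (suc a) G φ N = begin
  pairˢ G (λ r m → shift (suc a) (λ s → φ s m) r) N              ≡⟨ pairˢ-cong G (λ r m → sym (shift-shift 1 a _ r)) N ⟩
  pairˢ G (λ r m → shift 1 (λ s → shift a (λ s → φ s m) s) r) N  ≡⟨ pairˢ-shift₁ G _ N ⟩
  shift 1 (pairˢ G (λ r m → shift a (λ s → φ s m) r)) N          ≡⟨ shift-cong 1 (pairˢ-shift a G φ) N ⟩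
  shift 1 (shift a (pairˢ G φ)) N                                ≡⟨ shift-shift 1 a _ N ⟩
  shift (suc a) (pairˢ G φ) N                                    ∎
  where open ≡-Reasoning

pairˢ-mono : ∀ a b φ N → pairˢ (z^ a t^ b) φ N ≡ shift a (λ r → φ r b) N
pairˢ-mono zero    b φ zero    = pairᴾ-t^ b _
pairˢ-mono zero    b φ (suc N) = trans (cong₂ _+ℤ_ (pairᴾ-t^ b _) (pairˢ-empty φ N)) (ℤₚ.+-identityʳ _)
pairˢ-mono (suc a) b φ zero    = refl
pairˢ-mono (suc a) b φ (suc N) = trans (ℤₚ.+-identityˡ _) (pairˢ-mono a b φ N)

-- Only coefficients up to `N` are compared, so that sums with bounds depending on `n` can be
-- replaced by sums with one bound `K`.
pairˢ-sumTo : ∀ K {G} (X : ℕ → Series) φ N →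
         (∀ n f → n ≤ N → pairᴾ (G n) f ≡ sumTo K (λ k → pairᴾ (X k n) f)) → pairˢ G φ N ≡ sumTo K (λ k → pairˢ (X k) φ N)
pairˢ-sumTo K X φ zero    e = e 0 _ z≤n
pairˢ-sumTo K X φ (suc N) e = trans
  (cong₂ _+ℤ_ (e 0 _ z≤n) (pairˢ-sumTo K (λ k → X k ∘ suc) φ N (λ n f l → e (suc n) f (s≤s l))))
  (sym (sumTo-+ K _ _))

pairˢ≡sumTo : ∀ G φ N → pairˢ G φ N ≡ sumTo (suc N) (λ n → pairᴾ (G n) (λ m → shift n (λ r → φ r m) N))
pairˢ≡sumTo G φ zero    = sym (ℤₚ.+-identityʳ _)
pairˢ≡sumTo G φ (suc N) = cong (pairᴾ (G 0) (φ (suc N)) +ℤ_) (pairˢ≡sumTo (G ∘ suc) φ N)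

-- Demands that no weight be left over, so that pairing at `N` extracts the coefficient of z^N.
atZero : (ℕ → ℤ) → Test
atZero f zero    m = f m
atZero f (suc _) m = 0ℤ

pairˢ-atZero : ∀ G f N → pairˢ G (atZero f) N ≡ pairᴾ (G N) f
pairˢ-atZero G f zero    = refl
pairˢ-atZero G f (suc N) = trans (cong₂ _+ℤ_ (pairᴾ-zero (G 0) (λ _ → refl)) (pairˢ-atZero (G ∘ suc) f N)) (ℤₚ.+-identityˡ _)

-- Geometric series under the pairing

mono-zero : ∀ a b f {n} → n < a → pairᴾ ((z^ a t^ b) n) f ≡ 0ℤ
mono-zero a b f {n} l = trans (sym (pairˢ-atZero (z^ a t^ b) f n)) (trans (pairˢ-mono a b (atZero f) n) (shift-small a _ l))

-- The k-th power has weight at least k because the exponent of z is positive; any bound beyond `N`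
-- therefore agrees with the cut at `n` for all n ≤ N.
geo-sumTo : ∀ a b φ N {K} → N < K →
          pairˢ (1/1-z^ suc a t^ b) φ N ≡ sumTo K (λ k → shift (suc a * k) (λ r → φ r (b * k)) N)
geo-sumTo a b φ N {K} N<K = trans
  (pairˢ-sumTo K (λ k → z^ (suc a * k) t^ (b * k)) φ N truncate)
  (sumTo-cong K (λ k → pairˢ-mono (suc a * k) (b * k) φ N))
  where
  truncate : ∀ n f → n ≤ N →
             pairᴾ ((1/1-z^ suc a t^ b) n) f ≡ sumTo K (λ k → pairᴾ ((z^ (suc a * k) t^ (b * k)) n) f)
  truncate n f n≤N = trans
    (pairᴾ-∑ (λ k → (z^ (suc a * k) t^ (b * k)) n) (suc n) id f)
    (sumTo-extend (λ k → pairᴾ ((z^ (suc a * k) t^ (b * k)) n) f) (ℕₚ.≤-trans (s≤s n≤N) N<K)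
      (λ i n<i → mono-zero (suc a * i) (b * i) f (ℕₚ.≤-trans n<i (ℕₚ.m≤m+n i (a * i)))))

-- The identity 1/(1 - x) = 1 + x/(1 - x) for x = z^(a+1) t^b.
geo-rec : ∀ a b φ N → pairˢ (1/1-z^ suc a t^ b) φ N ≡
          φ N 0 +ℤ shift (suc a) (pairˢ (1/1-z^ suc a t^ b) (λ r m → φ r (b + m))) N
geo-rec a b φ N = begin
  pairˢ (1/1-z^ suc a t^ b) φ N
    ≡⟨ geo-sumTo a b φ N ℕₚ.≤-refl ⟩
  shift (suc a * 0) (λ r → φ r (b * 0)) N +ℤ sumTo N (λ k → shift (suc a * suc k) (λ r → φ r (b * suc k)) N)
    ≡⟨ cong₂ _+ℤ_ (cong₂ (λ x y → shift x (λ r → φ r y) N) (ℕₚ.*-zeroʳ (suc a)) (ℕₚ.*-zeroʳ b))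
         (sumTo-cong N (λ k → trans
           (cong₂ (λ x y → shift x (λ r → φ r y) N) (ℕₚ.*-suc (suc a) k) (ℕₚ.*-suc b k))
           (sym (shift-shift (suc a) (suc a * k) _ N)))) ⟩
  φ N 0 +ℤ sumTo N (λ k → shift (suc a) (shift (suc a * k) (λ r → φ r (b + b * k))) N)
    ≡⟨ cong (φ N 0 +ℤ_) (sym (shift-sumTo (suc a) N _ N)) ⟩
  φ N 0 +ℤ shift (suc a) (λ s → sumTo N (λ k → shift (suc a * k) (λ r → φ r (b + b * k)) s)) N
    -- After the shift the remaining weight is below `N`, so `N` terms are enough to rebuild the
    -- series.
    ≡⟨ cong (φ N 0 +ℤ_) (shift-cong-≤ (suc a) N (λ s e →
         sym (geo-sumTo a b (λ r m → φ r (b + m)) s (ℕₚ.≤-trans (s≤s (ℕₚ.m≤n+m s a)) (ℕₚ.≤-reflexive e))))) ⟩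
  φ N 0 +ℤ shift (suc a) (pairˢ (1/1-z^ suc a t^ b) (λ r m → φ r (b + m))) N ∎
  where open ≡-Reasoning

-- ∑ φ (r - k) k over k < m with k ≤ r.
antidiagonal : ℕ → Test → ℕ → ℤ
antidiagonal zero    φ r = 0ℤ
antidiagonal (suc m) φ r = antidiagonal m φ r +ℤ shift m (λ s → φ s m) r

-- The pairing with t^i/(1 - zt): the sum of φ (r - k) (i + k) over k ≤ r.
diagonal : Test → Test
diagonal φ r i = pairˢ (1/1-z^ 1 t^ 1) (λ s m → φ s (i + m)) r

diagonal-rec : ∀ φ r i → diagonal φ r i ≡ φ r i +ℤ shift 1 (λ s → diagonal φ s (suc i)) r
diagonal-rec φ r i = trans (geo-rec 0 1 (λ s m → φ s (i + m)) r) (cong₂ _+ℤ_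
  (cong (φ r) (ℕₚ.+-identityʳ i))
  (shift-cong 1 (λ s → pairˢ-cong (1/1-z^ 1 t^ 1) (λ r m → cong (φ r) (ℕₚ.+-suc i m)) s) r))

-- The first m terms of 1/(1 - zt) are split off; the tail is (zt)^m/(1 - zt).
diagonal-split : ∀ φ m r → diagonal φ r 0 ≡ antidiagonal m φ r +ℤ shift m (λ s → diagonal φ s m) r
diagonal-split φ zero    r = sym (ℤₚ.+-identityˡ _)
diagonal-split φ (suc m) r = begin
  diagonal φ r 0
    ≡⟨ diagonal-split φ m r ⟩
  antidiagonal m φ r +ℤ shift m (λ s → diagonal φ s m) r
    ≡⟨ cong (antidiagonal m φ r +ℤ_) (trans (shift-cong m (λ s → diagonal-rec φ s m) r) (shift-+ m _ _ r)) ⟩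
  antidiagonal m φ r +ℤ (shift m (λ s → φ s m) r +ℤ shift m (shift 1 (λ s → diagonal φ s (suc m))) r)
    ≡⟨ cong (λ x → antidiagonal m φ r +ℤ (shift m (λ s → φ s m) r +ℤ x))
         (trans (shift-shift m 1 _ r) (cong (λ x → shift x (λ s → diagonal φ s (suc m)) r) (ℕₚ.+-comm m 1))) ⟩
  antidiagonal m φ r +ℤ (shift m (λ s → φ s m) r +ℤ shift (suc m) (λ s → diagonal φ s (suc m)) r)
    ≡⟨ sym (ℤₚ.+-assoc (antidiagonal m φ r) _ _) ⟩
  antidiagonal (suc m) φ r +ℤ shift (suc m) (λ s → diagonal φ s (suc m)) r ∎
  where open ≡-Reasoning

-- Specializations of t under the pairing

pairˢ-at-t=1 : ∀ G φ N → pairˢ (at-t=1 G) φ N ≡ pairˢ G (λ r _ → φ r 0) N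
pairˢ-at-t=1 G φ zero    = trans (ℤₚ.+-identityʳ _) (sym (pairᴾ-const (G 0) _))
pairˢ-at-t=1 G φ (suc N) = cong₂ _+ℤ_ (trans (ℤₚ.+-identityʳ _) (sym (pairᴾ-const (G 0) _))) (pairˢ-at-t=1 (G ∘ suc) φ N)

onZero : Test → Test
onZero φ r zero    = φ r 0
onZero φ r (suc m) = 0ℤ

pairˢ-at-t=0 : ∀ G φ N → pairˢ (at-t=0 G) φ N ≡ pairˢ G (onZero φ) N
pairˢ-at-t=0 G φ N = go G N
  where
  const-coeff : ∀ p f {g : ℕ → ℤ} → f 0 ≡ g 0 → (∀ m → g (suc m) ≡ 0ℤ) → pairᴾ (const (coeff p 0)) f ≡ pairᴾ p g
  const-coeff []      f e z = refl
  const-coeff (a ∷ p) f e z = cong₂ (λ x y → a *ℤ x +ℤ y) e (sym (pairᴾ-zero p z))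

  go : ∀ G N → pairˢ (at-t=0 G) φ N ≡ pairˢ G (onZero φ) N
  go G zero    = const-coeff (G 0) (φ 0) refl (λ _ → refl)
  go G (suc N) = cong₂ _+ℤ_ (const-coeff (G 0) (φ (suc N)) refl (λ _ → refl)) (go (G ∘ suc) N)

tailˢ : Series → Series
tailˢ G n = drop 1 (G n)

pairᴾ-tail : ∀ p f → pairᴾ p f ≡ coeff p 0 *ℤ f 0 +ℤ pairᴾ (drop 1 p) (f ∘ suc)
pairᴾ-tail []      f = refl
pairᴾ-tail (a ∷ p) f = refl

-- Here `c` holds the terms with t^0, and `K` the others divided by t. Using it on both G(z,zt) and
-- G makes their t^0 sums coincide literally.
pairˢ-split : ∀ {H K} (c : ℕ → ℤ) φ N → (∀ n f → pairᴾ (H n) f ≡ c n *ℤ f 0 +ℤ pairᴾ (K n) (f ∘ suc)) →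
           pairˢ H φ N ≡ sumTo (suc N) (λ n → c n *ℤ shift n (λ r → φ r 0) N) +ℤ pairˢ K (λ r m → φ r (suc m)) N
pairˢ-split         c φ zero    e = trans (e 0 _) (cong (_+ℤ _) (sym (ℤₚ.+-identityʳ (c 0 *ℤ φ 0 0))))
pairˢ-split {H} {K} c φ (suc N) e = trans
  (cong₂ _+ℤ_ (e 0 (φ (suc N))) (pairˢ-split {H ∘ suc} {K ∘ suc} (c ∘ suc) φ N (e ∘ suc)))
  (interchange (c 0 *ℤ φ (suc N) 0) _ _ _)

-- With T = (G - G(z,0))/t one has G(z,zt) = G(z,0) + zt T(z,zt); the factor z lowers the index from
-- `suc n` to `n`.
at-t=zt-suc : ∀ G n f → pairᴾ (at-t=zt G (suc n)) f ≡ coeff (G (suc n)) 0 *ℤ f 0 +ℤ pairᴾ (at-t=zt (tailˢ G) n) (f ∘ suc)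
at-t=zt-suc G n f = cong (coeff (G (suc n)) 0 *ℤ f 0 +ℤ_)
  (go {λ m → coeff (G (suc n ∸ m)) m} {λ m → coeff (tailˢ G (n ∸ m)) m}
      (suc n) suc id (λ k → coeff-drop (G (n ∸ k)) k) (f ∘ suc))
  where
  coeff-drop : ∀ p k → coeff p (suc k) ≡ coeff (drop 1 p) k
  coeff-drop []      k = refl
  coeff-drop (a ∷ p) k = refl

  go : ∀ {h h′ : ℕ → ℤ} k (g g′ : ℕ → ℕ) → (∀ i → h (g i) ≡ h′ (g′ i)) → ∀ f →
       pairᴾ (map h (applyUpTo g k)) f ≡ pairᴾ (map h′ (applyUpTo g′ k)) f
  go zero    g g′ e f = refl
  go (suc k) g g′ e f = cong₂ (λ x y → x *ℤ f 0 +ℤ y) (e 0) (go k (g ∘ suc) (g′ ∘ suc) (e ∘ suc) (f ∘ suc))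

-- Each factor t uses up one more unit of weight. Peeling off t^0 leaves a factor zt, hence the
-- induction on `N`.
pairˢ-at-t=zt : ∀ G φ N → pairˢ (at-t=zt G) φ N ≡ pairˢ G (λ r m → shift m (λ s → φ s m) r) N
pairˢ-at-t=zt G φ zero    = sym (trans (pairᴾ-tail (G 0) _) (cong (coeff (G 0) 0 *ℤ φ 0 0 +ℤ_) (pairᴾ-zero (drop 1 (G 0)) (λ _ → refl))))
pairˢ-at-t=zt G φ (suc N) = begin
  (c₀ +ℤ 0ℤ) +ℤ pairˢ (at-t=zt G ∘ suc) φ N
    ≡⟨ cong₂ _+ℤ_ (ℤₚ.+-identityʳ c₀) (pairˢ-split {at-t=zt G ∘ suc} {at-t=zt (tailˢ G)} (λ n → coeff (G (suc n)) 0) φ N (at-t=zt-suc G)) ⟩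
  c₀ +ℤ (S +ℤ pairˢ (at-t=zt (tailˢ G)) (λ r m → φ r (suc m)) N)
    ≡⟨ sym (ℤₚ.+-assoc c₀ S _) ⟩
  (c₀ +ℤ S) +ℤ pairˢ (at-t=zt (tailˢ G)) (λ r m → φ r (suc m)) N
    ≡⟨ cong ((c₀ +ℤ S) +ℤ_) (pairˢ-at-t=zt (tailˢ G) (λ r m → φ r (suc m)) N) ⟩
  (c₀ +ℤ S) +ℤ pairˢ (tailˢ G) (λ r m → shift m (λ s → φ s (suc m)) r) N
    ≡⟨ cong ((c₀ +ℤ S) +ℤ_) (sym (pairˢ-shift₁ (tailˢ G) (λ r m → shift m (λ s → φ s (suc m)) r) (suc N))) ⟩
  (c₀ +ℤ S) +ℤ pairˢ (tailˢ G) (λ r m → shift 1 (shift m (λ s → φ s (suc m))) r) (suc N)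
    ≡⟨ cong ((c₀ +ℤ S) +ℤ_) (pairˢ-cong (tailˢ G) (λ r m → shift-shift 1 m _ r) (suc N)) ⟩
  (c₀ +ℤ S) +ℤ pairˢ (tailˢ G) (λ r m → shift (suc m) (λ s → φ s (suc m)) r) (suc N)
    ≡⟨ sym (pairˢ-split {G} {tailˢ G} (λ n → coeff (G n) 0) (λ r m → shift m (λ s → φ s m) r) (suc N) (λ n → pairᴾ-tail (G n))) ⟩
  pairˢ G (λ r m → shift m (λ s → φ s m) r) (suc N) ∎
  where
  open ≡-Reasoning
  c₀ = coeff (G 0) 0 *ℤ φ (suc N) 0
  S = sumTo (suc N) (λ n → coeff (G (suc n)) 0 *ℤ shift n (λ r → φ r 0) N)

-- Transposes of the operators

transposeE : Test → Test
transposeE φ r m = antidiagonal (suc m) φ r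

-- Both summands are infinite geometric series; `first` cuts the one from G(z,1) after (zt)^m, and
-- `second` identifies the other with the tail `X`, which cancels.
pairˢ-applyE : ∀ G φ N → pairˢ (applyE G) φ N ≡ pairˢ G (transposeE φ) N
pairˢ-applyE G φ N = begin
  pairˢ (applyE G) φ N
    ≡⟨ pairˢ-⊛ (at-t=1 G ⊖ (z^ 1 t^ 1) ⊛ at-t=zt G) (1/1-z^ 1 t^ 1) φ N ⟩
  pairˢ (at-t=1 G ⊖ (z^ 1 t^ 1) ⊛ at-t=zt G) (diagonal φ) N
    ≡⟨ pairˢ-⊖ (at-t=1 G) ((z^ 1 t^ 1) ⊛ at-t=zt G) (diagonal φ) N ⟩
  pairˢ (at-t=1 G) (diagonal φ) N +ℤ -ℤ pairˢ ((z^ 1 t^ 1) ⊛ at-t=zt G) (diagonal φ) N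
    ≡⟨ cong₂ (λ x y → x +ℤ -ℤ y) first second ⟩
  (pairˢ G (transposeE φ) N +ℤ X) +ℤ -ℤ X
    ≡⟨ cancel (pairˢ G (transposeE φ) N) X ⟩
  pairˢ G (transposeE φ) N ∎
  where
  open ≡-Reasoning
  X = pairˢ G (λ r m → shift (suc m) (λ s → diagonal φ s (suc m)) r) N

  cancel : ∀ a b → (a +ℤ b) +ℤ -ℤ b ≡ a
  cancel = solve-∀

  first : pairˢ (at-t=1 G) (diagonal φ) N ≡ pairˢ G (transposeE φ) N +ℤ X
  first = begin
    pairˢ (at-t=1 G) (diagonal φ) N     ≡⟨ pairˢ-at-t=1 G (diagonal φ) N ⟩
    pairˢ G (λ r _ → diagonal φ r 0) N  ≡⟨ pairˢ-cong G (λ r m → diagonal-split φ (suc m) r) N ⟩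
    _                                   ≡⟨ pairˢ-+ G (transposeE φ) _ N ⟩
    pairˢ G (transposeE φ) N +ℤ X       ∎

  second : pairˢ ((z^ 1 t^ 1) ⊛ at-t=zt G) (diagonal φ) N ≡ X
  second = begin
    pairˢ ((z^ 1 t^ 1) ⊛ at-t=zt G) (diagonal φ) N
      ≡⟨ pairˢ-⊛ (z^ 1 t^ 1) (at-t=zt G) (diagonal φ) N ⟩
    pairˢ (z^ 1 t^ 1) (λ r a → pairˢ (at-t=zt G) (λ s b → diagonal φ s (a + b)) r) N
      ≡⟨ pairˢ-mono 1 1 _ N ⟩
    shift 1 (pairˢ (at-t=zt G) (λ s b → diagonal φ s (suc b))) N
      ≡⟨ shift-cong 1 (pairˢ-at-t=zt G (λ s b → diagonal φ s (suc b))) N ⟩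
    shift 1 (pairˢ G (λ r m → shift m (λ s → diagonal φ s (suc m)) r)) N
      ≡⟨ sym (pairˢ-shift₁ G _ N) ⟩
    pairˢ G (λ r m → shift 1 (shift m (λ s → diagonal φ s (suc m))) r) N
      ≡⟨ pairˢ-cong G (λ r m → shift-shift 1 m _ r) N ⟩
    X ∎

-- The power t^0 is fixed, as the summand G(z,0) demands: after a missing column only missing
-- columns follow.
transposeN : Test → Test
transposeN φ r zero    = φ r 0
transposeN φ r (suc m) = pairˢ (1/1-z^ suc m t^ 0) (λ s a → antidiagonal (suc m) (λ r b → φ r (a + b)) s) r

transposeN-rec : ∀ φ r m → transposeN φ r (suc m) ≡
                 antidiagonal (suc m) φ r +ℤ shift (suc m) (λ s → transposeN φ s (suc m)) r
transposeN-rec φ r m = geo-rec m 0 _ r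

pairˢ-termN : ∀ n m φ N → pairˢ (termN n (suc m)) φ N ≡ shift n (λ r → transposeN φ r (suc m)) N
pairˢ-termN n m φ N = begin
  pairˢ (termN n (suc m)) φ N
    ≡⟨ pairˢ-⊛ (A ⊛ Y) (z^ n t^ 0) φ N ⟩
  pairˢ (A ⊛ Y) (λ r a → pairˢ (z^ n t^ 0) (λ s b → φ s (a + b)) r) N
    ≡⟨ pairˢ-cong (A ⊛ Y) (λ r a → trans (pairˢ-mono n 0 _ r)
         (shift-cong n (λ s → cong (φ s) (ℕₚ.+-identityʳ a)) r)) N ⟩
  pairˢ (A ⊛ Y) (λ r a → shift n (λ s → φ s a) r) N
    ≡⟨ pairˢ-shift n (A ⊛ Y) φ N ⟩
  shift n (pairˢ (A ⊛ Y) φ) N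
    ≡⟨ shift-cong n (λ r → trans (pairˢ-⊛ A Y φ r) (pairˢ-cong A (λ s a → pairˢ-Y (λ s b → φ s (a + b)) s) r)) N ⟩
  shift n (λ r → transposeN φ r (suc m)) N ∎
  where
  open ≡-Reasoning
  A = 1/1-z^ suc m t^ 0
  Y = (𝟙 ⊖ (z^ suc m t^ suc m)) ⊛ (1/1-z^ 1 t^ 1)

  cancel : ∀ a b → (a +ℤ b) +ℤ -ℤ b ≡ a
  cancel = solve-∀

  pairˢ-Y : ∀ φ r → pairˢ Y φ r ≡ antidiagonal (suc m) φ r
  pairˢ-Y φ r = begin
    pairˢ Y φ r
      ≡⟨ pairˢ-⊛ (𝟙 ⊖ (z^ suc m t^ suc m)) (1/1-z^ 1 t^ 1) φ r ⟩
    pairˢ (𝟙 ⊖ (z^ suc m t^ suc m)) (diagonal φ) r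
      ≡⟨ pairˢ-⊖ 𝟙 (z^ suc m t^ suc m) (diagonal φ) r ⟩
    pairˢ 𝟙 (diagonal φ) r +ℤ -ℤ pairˢ (z^ suc m t^ suc m) (diagonal φ) r
      ≡⟨ cong₂ (λ x y → x +ℤ -ℤ y) (trans (pairˢ-mono 0 0 (diagonal φ) r) (diagonal-split φ (suc m) r))
                                   (pairˢ-mono (suc m) (suc m) (diagonal φ) r) ⟩
    (antidiagonal (suc m) φ r +ℤ shift (suc m) (λ s → diagonal φ s (suc m)) r) +ℤ -ℤ shift (suc m) (λ s → diagonal φ s (suc m)) r
      ≡⟨ cancel (antidiagonal (suc m) φ r) _ ⟩
    antidiagonal (suc m) φ r ∎

onPositive : Test → Test
onPositive φ r zero    = 0ℤ
onPositive φ r (suc m) = φ r (suc m)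

-- The double sum in 𝓝 starts at n = 1, so a coefficient of z^0 would lose its terms with m ≥ 1;
-- hence the hypothesis. The test is split into m = 0, served by G(z,0), and m ≥ 1, served by the
-- double sum.
pairˢ-applyN : ∀ G φ N → (∀ f → pairᴾ (G 0) f ≡ 0ℤ) → pairˢ (applyN G) φ N ≡ pairˢ G (transposeN φ) N
pairˢ-applyN G φ N G₀ = begin
  pairˢ (applyN G) φ N
    ≡⟨ pairˢ-⊕ (at-t=0 G) terms φ N ⟩
  pairˢ (at-t=0 G) φ N +ℤ pairˢ terms φ N
    ≡⟨ cong₂ _+ℤ_ (pairˢ-at-t=0 G φ N) pairˢ-terms ⟩
  pairˢ G (onZero φ) N +ℤ pairˢ G (onPositive (transposeN φ)) N
    ≡⟨ sym (pairˢ-+ G (onZero φ) _ N) ⟩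
  pairˢ G (λ r m → onZero φ r m +ℤ onPositive (transposeN φ) r m) N
    ≡⟨ pairˢ-cong G (λ { r zero → ℤₚ.+-identityʳ _ ; r (suc m) → ℤₚ.+-identityˡ _ }) N ⟩
  pairˢ G (transposeN φ) N ∎
  where
  open ≡-Reasoning
  row : ℕ → Series
  row n N = ∑ (map (λ m → coeff (G n) m ·ᴾ termN n m N) (1⋯ length (G n)))

  terms : Series
  terms N = ∑ (map (λ n → row n N) (1⋯ N))

  pairᴾ-row : ∀ n N f → pairᴾ (row n N) f ≡
             sumTo (length (G n)) (λ m → coeff (G n) (suc m) *ℤ pairᴾ (termN n (suc m) N) f)
  pairᴾ-row n N f = trans
    (pairᴾ-∑₁ (λ m → coeff (G n) m ·ᴾ termN n m N) (length (G n)) id f)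
    (sumTo-cong (length (G n)) (λ m → pairᴾ-·ᴾ (coeff (G n) (suc m)) (termN n (suc m) N) f))

  -- A row of index n > N has no term at z^N, so the bound `1⋯ N` of the sum can be raised to a
  -- fixed one.
  row-zero : ∀ n {N} f → N < n → pairᴾ (row n N) f ≡ 0ℤ
  row-zero n {N} f l = trans (pairᴾ-row n N f) (sumTo-zero (length (G n)) (λ m → trans
    (cong (coeff (G n) (suc m) *ℤ_) (trans (sym (pairˢ-atZero (termN n (suc m)) f N))
      (trans (pairˢ-termN n m (atZero f) N) (shift-small n _ l))))
    (ℤₚ.*-zeroʳ (coeff (G n) (suc m)))))

  -- The left sum runs from 1 to `length p`, one index past the list, where the coefficient is 0;
  -- the missing index 0 is killed by `f 0 ≡ 0ℤ`.
  pairᴾ-onPositive : ∀ p (f : ℕ → ℤ) → f 0 ≡ 0ℤ → sumTo (length p) (λ m → coeff p (suc m) *ℤ f (suc m)) ≡ pairᴾ p f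
  pairᴾ-onPositive p f e = sym (begin
    pairᴾ p f
      ≡⟨ pairᴾ≡sumTo p f ⟩
    sumTo (length p) (λ m → coeff p m *ℤ f m)
      ≡⟨ sumTo-extend (λ m → coeff p m *ℤ f m) (ℕₚ.n≤1+n _) (λ i l → trans (cong (_*ℤ f i) (coeff-beyond p i l)) (ℤₚ.*-zeroˡ (f i))) ⟩
    coeff p 0 *ℤ f 0 +ℤ S
      ≡⟨ cong (λ x → coeff p 0 *ℤ x +ℤ S) e ⟩
    coeff p 0 *ℤ 0ℤ +ℤ S
      ≡⟨ cong (_+ℤ S) (ℤₚ.*-zeroʳ (coeff p 0)) ⟩
    0ℤ +ℤ S
      ≡⟨ ℤₚ.+-identityˡ S ⟩
    S ∎)
    where S = sumTo (length p) (λ m → coeff p (suc m) *ℤ f (suc m))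

  pairˢ-row : ∀ n → pairˢ (row n) φ N ≡ pairᴾ (G n) (λ m → shift n (λ r → onPositive (transposeN φ) r m) N)
  pairˢ-row n = begin
    pairˢ (row n) φ N
      ≡⟨ pairˢ-sumTo (length (G n)) (λ m i → coeff (G n) (suc m) ·ᴾ termN n (suc m) i) φ N
           (λ i f _ → trans (pairᴾ-row n i f) (sumTo-cong (length (G n)) (λ m → sym (pairᴾ-·ᴾ (coeff (G n) (suc m)) (termN n (suc m) i) f)))) ⟩
    sumTo (length (G n)) (λ m → pairˢ (λ i → coeff (G n) (suc m) ·ᴾ termN n (suc m) i) φ N)
      ≡⟨ sumTo-cong (length (G n)) (λ m → trans (pairˢ-·ᴾ (coeff (G n) (suc m)) (termN n (suc m)) N)
           (cong (coeff (G n) (suc m) *ℤ_) (pairˢ-termN n m φ N))) ⟩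
    sumTo (length (G n)) (λ m → coeff (G n) (suc m) *ℤ shift n (λ r → transposeN φ r (suc m)) N)
      ≡⟨ pairᴾ-onPositive (G n) (λ m → shift n (λ r → onPositive (transposeN φ) r m) N) (shift-zero n N) ⟩
    pairᴾ (G n) (λ m → shift n (λ r → onPositive (transposeN φ) r m) N) ∎
    where
    pairˢ-·ᴾ : ∀ c H N → pairˢ (λ i → c ·ᴾ H i) φ N ≡ c *ℤ pairˢ H φ N
    pairˢ-·ᴾ c H zero    = pairᴾ-·ᴾ c (H 0) _
    pairˢ-·ᴾ c H (suc N) = trans (cong₂ _+ℤ_ (pairᴾ-·ᴾ c (H 0) _) (pairˢ-·ᴾ c (H ∘ suc) N)) (sym (ℤₚ.*-distribˡ-+ c _ _))

  pairˢ-terms : pairˢ terms φ N ≡ pairˢ G (onPositive (transposeN φ)) N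
  pairˢ-terms = begin
    pairˢ terms φ N
      ≡⟨ pairˢ-sumTo N (λ n → row (suc n)) φ N (λ n f l → trans (pairᴾ-∑₁ (λ i → row i n) n id f)
           (sumTo-extend (λ i → pairᴾ (row (suc i) n) f) l (λ i q → row-zero (suc i) f (s≤s q)))) ⟩
    sumTo N (λ n → pairˢ (row (suc n)) φ N)
      ≡⟨ sumTo-cong N (λ n → pairˢ-row (suc n)) ⟩
    sumTo N (λ n → pairᴾ (G (suc n)) (λ m → shift (suc n) (λ r → onPositive (transposeN φ) r m) N))
      ≡⟨ sym (ℤₚ.+-identityˡ _) ⟩
    0ℤ +ℤ sumTo N (λ n → pairᴾ (G (suc n)) (λ m → shift (suc n) (λ r → onPositive (transposeN φ) r m) N))
      ≡⟨ cong (_+ℤ sumTo N (λ n → pairᴾ (G (suc n)) (λ m → shift (suc n) (λ r → onPositive (transposeN φ) r m) N))) (sym (G₀ _)) ⟩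
    sumTo (suc N) (λ n → pairᴾ (G n) (λ m → shift n (λ r → onPositive (transposeN φ) r m) N))
      ≡⟨ sym (pairˢ≡sumTo G (onPositive (transposeN φ)) N) ⟩
    pairˢ G (onPositive (transposeN φ)) N ∎

transpose : Op → Test → Test
transpose 𝓔 = transposeE
transpose 𝓝 = transposeN

pairˢ-apply : ∀ o G φ N → (∀ f → pairᴾ (G 0) f ≡ 0ℤ) → pairˢ (apply o G) φ N ≡ pairˢ G (transpose o φ) N
pairˢ-apply 𝓔 G φ N _  = pairˢ-applyE G φ N
pairˢ-apply 𝓝 G φ N G₀ = pairˢ-applyN G φ N G₀

transposeAll : List Op → Test → Test
transposeAll ops φ = foldr transpose φ ops

pairˢ-applyAll : ∀ ops G φ N → (∀ f → pairᴾ (G 0) f ≡ 0ℤ) → pairˢ (applyAll ops G) φ N ≡ pairˢ G (transposeAll ops φ) N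
pairˢ-applyAll []        G φ N G₀ = refl
pairˢ-applyAll (o ∷ ops) G φ N G₀ = trans
  -- Transposing at N = 0 shows that the vanishing of the z^0 coefficient survives each operator.
  (pairˢ-applyAll ops (apply o G) φ N (λ f → trans (pairˢ-apply o G (atZero f) 0 G₀) (G₀ _)))
  (pairˢ-apply o G (transposeAll ops φ) N G₀)

-- From zt/(1 - zt) + 1 = 1/(1 - zt): the extra `φ N 0` admits a first column of height 0, and
-- heights above `N` have no room.
pairˢ-initial : ∀ φ N → pairˢ ((z^ 1 t^ 1) ⊛ (1/1-z^ 1 t^ 1)) φ N +ℤ φ N 0 ≡ antidiagonal (suc N) φ N
pairˢ-initial φ N = begin
  pairˢ ((z^ 1 t^ 1) ⊛ (1/1-z^ 1 t^ 1)) φ N +ℤ φ N 0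
    ≡⟨ cong (_+ℤ φ N 0) (trans (pairˢ-⊛ (z^ 1 t^ 1) (1/1-z^ 1 t^ 1) φ N) (pairˢ-mono 1 1 (diagonal φ) N)) ⟩
  shift 1 (λ s → diagonal φ s 1) N +ℤ φ N 0
    ≡⟨ ℤₚ.+-comm _ (φ N 0) ⟩
  φ N 0 +ℤ shift 1 (λ s → diagonal φ s 1) N
    ≡⟨ sym (diagonal-rec φ N 0) ⟩
  diagonal φ N 0
    ≡⟨ diagonal-split φ (suc N) N ⟩
  antidiagonal (suc N) φ N +ℤ shift (suc N) (λ s → diagonal φ s (suc N)) N
    ≡⟨ cong (antidiagonal (suc N) φ N +ℤ_) (shift-small (suc N) _ ℕₚ.≤-refl) ⟩
  antidiagonal (suc N) φ N +ℤ 0ℤ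
    ≡⟨ ℤₚ.+-identityʳ _ ⟩
  antidiagonal (suc N) φ N ∎
  where open ≡-Reasoning

pairˢ-initial-zero : ∀ φ → pairˢ ((z^ 1 t^ 1) ⊛ (1/1-z^ 1 t^ 1)) φ 0 ≡ 0ℤ
pairˢ-initial-zero φ = trans (pairˢ-⊛ (z^ 1 t^ 1) (1/1-z^ 1 t^ 1) φ 0) (pairˢ-mono 1 1 (diagonal φ) 0)

-- Sums over lists, and indicators

sumOver : ∀ {A : Set} → (A → ℤ) → List A → ℤ
sumOver f = foldr (λ x s → f x +ℤ s) 0ℤ

module _ {A : Set} where

  sumOver-cong : ∀ {f g : A → ℤ} xs → (∀ x → x ∈ xs → f x ≡ g x) → sumOver f xs ≡ sumOver g xs
  sumOver-cong []       e = refl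
  sumOver-cong (x ∷ xs) e = cong₂ _+ℤ_ (e x (here refl)) (sumOver-cong xs (λ y → e y ∘ there))

  sumOver-++ : ∀ (f : A → ℤ) xs ys → sumOver f (xs ++ ys) ≡ sumOver f xs +ℤ sumOver f ys
  sumOver-++ f []       ys = sym (ℤₚ.+-identityˡ _)
  sumOver-++ f (x ∷ xs) ys = trans (cong (f x +ℤ_) (sumOver-++ f xs ys)) (sym (ℤₚ.+-assoc (f x) _ _))

  sumOver-+ : ∀ (f g : A → ℤ) xs → sumOver (λ x → f x +ℤ g x) xs ≡ sumOver f xs +ℤ sumOver g xs
  sumOver-+ f g []       = refl
  sumOver-+ f g (x ∷ xs) = trans (cong (f x +ℤ g x +ℤ_) (sumOver-+ f g xs)) (interchange (f x) (g x) _ _)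

  sumOver-↭ : ∀ (f : A → ℤ) {xs ys} → xs ↭ ys → sumOver f xs ≡ sumOver f ys
  sumOver-↭ f Perm.refl         = refl
  sumOver-↭ f (Perm.prep x p)   = cong (f x +ℤ_) (sumOver-↭ f p)
  sumOver-↭ f (Perm.swap x y p) = trans (x∙yz≈y∙xz (f x) (f y) _) (cong (λ s → f y +ℤ (f x +ℤ s)) (sumOver-↭ f p))
  sumOver-↭ f (Perm.trans p q)  = trans (sumOver-↭ f p) (sumOver-↭ f q)

  sumOver-map : ∀ {B : Set} (f : A → ℤ) (g : B → A) xs → sumOver f (map g xs) ≡ sumOver (f ∘ g) xs
  sumOver-map f g []       = refl
  sumOver-map f g (x ∷ xs) = cong (f (g x) +ℤ_) (sumOver-map f g xs)

δ-refl : ∀ n → δ n n ≡ 1ℤ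
δ-refl zero    = refl
δ-refl (suc n) = δ-refl n

δ-≢ : ∀ {m n} → m ≢ n → δ m n ≡ 0ℤ
δ-≢ {zero}  {zero}  e = contradiction refl e
δ-≢ {zero}  {suc n} e = refl
δ-≢ {suc m} {zero}  e = refl
δ-≢ {suc m} {suc n} e = δ-≢ (e ∘ cong suc)

indicator : ∀ {P : Set} → Dec P → ℤ
indicator d = if does d then 1ℤ else 0ℤ

indicator-yes : ∀ {P : Set} (d : Dec P) → P → indicator d ≡ 1ℤ
indicator-yes d p = cong (if_then 1ℤ else 0ℤ) (dec-true d p)

indicator-no : ∀ {P : Set} (d : Dec P) → ¬ P → indicator d ≡ 0ℤ
indicator-no d ¬p = cong (if_then 1ℤ else 0ℤ) (dec-false d ¬p)

indicator-≟ : ∀ m n → indicator (m ≟ n) ≡ δ m n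
indicator-≟ m n with m ≟ n
... | yes refl = trans (indicator-yes (m ≟ m) refl) (sym (δ-refl m))
... | no  m≢n  = trans (indicator-no (m ≟ n) m≢n) (sym (δ-≢ m≢n))

sumOver-filter : ∀ {A : Set} {P : Pred A 0ℓ} (P? : Decidable P) (f : A → ℤ) xs →
                 sumOver f (filter P? xs) ≡ sumOver (λ x → indicator (P? x) *ℤ f x) xs
sumOver-filter P? f []       = refl
sumOver-filter P? f (x ∷ xs) with P? x
... | yes _ = cong₂ _+ℤ_ (sym (ℤₚ.*-identityˡ (f x))) (sumOver-filter P? f xs)
... | no  _ = trans (sumOver-filter P? f xs) (sym (ℤₚ.+-identityˡ _))

-- Counting column lists

-- The length bound ℓ is immaterial as soon as s ≤ ℓ.
boxSum : (w ℓ : ℕ) → (List ℕ → ℤ) → ℕ → ℤ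
boxSum w ℓ f s = sumOver (λ cs → δ (sum cs) s *ℤ f cs) (box w ℓ)

boxSum-nil : ∀ w f s → boxSum w 0 f s ≡ δ 0 s *ℤ f []
boxSum-nil zero    f s = ℤₚ.+-identityʳ _
boxSum-nil (suc w) f s = ℤₚ.+-identityʳ _

shift-sumOver : ∀ a (f : List ℕ → ℤ) s xs → shift a (λ r → sumOver (λ cs → δ (sum cs) r *ℤ f cs) xs) s
                                        ≡ sumOver (λ cs → δ (a + sum cs) s *ℤ f cs) xs
shift-sumOver zero    f s       xs       = refl
shift-sumOver (suc a) f zero    []       = refl
shift-sumOver (suc a) f zero    (x ∷ xs) = trans (shift-sumOver (suc a) f zero xs) (sym (ℤₚ.+-identityˡ _))
shift-sumOver (suc a) f (suc s) xs       = shift-sumOver a f s xs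

-- Cases on whether the first column has the maximal height. The hypothesis is restricted to smaller
-- weights so that it can be supplied by induction on the weight.
boxSum-suc : ∀ w ℓ s f g → s ≤ ℓ →
             (∀ ℓ′ s′ → s′ ≤ ℓ′ → s′ < s → boxSum (suc w) ℓ′ (λ cs → f (suc w ∷ cs)) s′ ≡ g s′) →
             boxSum (suc w) ℓ f s ≡ boxSum w ℓ f s +ℤ shift (suc w) g s
boxSum-suc w zero    .0 f g z≤n e = trans (boxSum-nil (suc w) f 0) (sym (trans (ℤₚ.+-identityʳ _) (boxSum-nil w f 0)))
boxSum-suc w (suc ℓ) s  f g l   e = begin
  sumOver term (box w (suc ℓ) ++ map (suc w ∷_) (box (suc w) ℓ))
    ≡⟨ sumOver-++ term (box w (suc ℓ)) _ ⟩
  boxSum w (suc ℓ) f s +ℤ sumOver term (map (suc w ∷_) (box (suc w) ℓ))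
    ≡⟨ cong (boxSum w (suc ℓ) f s +ℤ_) (sumOver-map term (suc w ∷_) (box (suc w) ℓ)) ⟩
  boxSum w (suc ℓ) f s +ℤ sumOver (term ∘ (suc w ∷_)) (box (suc w) ℓ)
    ≡⟨ cong (boxSum w (suc ℓ) f s +ℤ_) (sym (shift-sumOver (suc w) (λ cs → f (suc w ∷ cs)) s (box (suc w) ℓ))) ⟩
  boxSum w (suc ℓ) f s +ℤ shift (suc w) (boxSum (suc w) ℓ (λ cs → f (suc w ∷ cs))) s
    ≡⟨ cong (boxSum w (suc ℓ) f s +ℤ_) (shift-cong-≤ (suc w) s (λ s′ q →
         let s′<s = ℕₚ.≤-trans (s≤s (ℕₚ.m≤n+m s′ w)) (ℕₚ.≤-reflexive q)
         in e ℓ s′ (s≤s⁻¹ (ℕₚ.≤-trans s′<s l)) s′<s)) ⟩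
  boxSum w (suc ℓ) f s +ℤ shift (suc w) g s ∎
  where
  open ≡-Reasoning
  term : List ℕ → ℤ
  term cs = δ (sum cs) s *ℤ f cs

-- Cases on the height of the first column, the empty list taking the place of height 0.
boxSum-antidiagonal : ∀ w ℓ s f φ → s ≤ ℓ → δ 0 s *ℤ f [] ≡ φ s 0 →
  (∀ c ℓ′ s′ → c < w → s′ ≤ ℓ′ → s′ < s → boxSum (suc c) ℓ′ (λ cs → f (suc c ∷ cs)) s′ ≡ φ s′ (suc c)) →
  boxSum w ℓ f s ≡ antidiagonal (suc w) φ s
boxSum-antidiagonal zero    ℓ s f φ l e₀ e = trans (ℤₚ.+-identityʳ _) (trans e₀ (sym (ℤₚ.+-identityˡ _)))
boxSum-antidiagonal (suc w) ℓ s f φ l e₀ e = trans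
  (boxSum-suc w ℓ s f (λ r → φ r (suc w)) l (λ ℓ′ s′ → e w ℓ′ s′ ℕₚ.≤-refl))
  (cong (_+ℤ shift (suc w) (λ r → φ r (suc w)) s)
    (boxSum-antidiagonal w ℓ s f φ l e₀ (λ c ℓ′ s′ q → e c ℓ′ s′ (ℕₚ.m≤n⇒m≤1+n q))))

boxSum-cong : ∀ w ℓ {f g} s → f ≗ g → boxSum w ℓ f s ≡ boxSum w ℓ g s
boxSum-cong w ℓ s e = sumOver-cong (box w ℓ) (λ cs _ → cong (δ (sum cs) s *ℤ_) (e cs))

boxSum-zero : ∀ w ℓ s → boxSum w ℓ (λ _ → 0ℤ) s ≡ 0ℤ
boxSum-zero w ℓ s = go (box w ℓ)
  where
  go : ∀ xs → sumOver (λ cs → δ (sum cs) s *ℤ 0ℤ) xs ≡ 0ℤ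
  go []       = refl
  go (x ∷ xs) = cong₂ _+ℤ_ (ℤₚ.*-zeroʳ (δ (sum x) s)) (go xs)

antidiagonal-onZero : ∀ w φ s → (∀ r m → φ r (suc m) ≡ 0ℤ) → antidiagonal (suc w) φ s ≡ φ s 0
antidiagonal-onZero zero    φ s e = ℤₚ.+-identityˡ _
antidiagonal-onZero (suc w) φ s e = trans
  (cong₂ _+ℤ_ (antidiagonal-onZero w φ s e) (trans (shift-cong (suc w) (λ r → e r w) s) (shift-zero (suc w) s)))
  (ℤₚ.+-identityʳ _)

-- Reads the columns of a partition from left to right, m being the height of the
-- last column read: 𝓔 reads one column; 𝓝 skips the columns of height m and reads
-- the next one.  A missing column counts as one of height 0.
final : List Op → ℕ → List ℕ → ℕ × List ℕ
final []        m cs       = m , cs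
final (𝓔 ∷ ops) m []       = final ops 0 []
final (𝓔 ∷ ops) m (c ∷ cs) = final ops c cs
final (𝓝 ∷ ops) m []       = final ops 0 []
final (𝓝 ∷ ops) m (c ∷ cs) = if does (c ≟ m) then final (𝓝 ∷ ops) m cs else final ops c cs

final-skip : ∀ ops m cs → final (𝓝 ∷ ops) m (m ∷ cs) ≡ final (𝓝 ∷ ops) m cs
final-skip ops m cs = cong (if_then final (𝓝 ∷ ops) m cs else final ops m cs) (dec-true (m ≟ m) refl)

final-smaller : ∀ ops {m c} cs → c < m → final (𝓝 ∷ ops) m (c ∷ cs) ≡ final ops c cs
final-smaller ops {m} {c} cs c<m = cong (if_then final (𝓝 ∷ ops) m cs else final ops c cs) (dec-false (c ≟ m) (ℕₚ.<⇒≢ c<m))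

value : ℕ → ℕ × List ℕ → ℤ
value M (m , [])    = δ m M
value M (m , _ ∷ _) = 0ℤ

module _ (M : ℕ) where

  count : List Op → Test
  count ops = transposeAll ops (atZero (λ m → δ m M))

  -- Splitting off the next column gives both sides the same recursion: `antidiagonal` for 𝓔 and
  -- `transposeN-rec` for 𝓝.
  boxSum-value : ∀ ops m ℓ s → s ≤ ℓ → boxSum m ℓ (λ cs → value M (final ops m cs)) s ≡ count ops s m

  -- This is `boxSum-value` at height 0, where the empty list is the only one in the box; it
  -- supplies the term k = 0 of every `antidiagonal`.
  nil-value : ∀ ops s → δ 0 s *ℤ value M (final ops 0 []) ≡ count ops s 0
  nil-value ops s = trans (sym (ℤₚ.+-identityʳ _)) (boxSum-value ops 0 s s ℕₚ.≤-refl)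

  boxSum-value [] m ℓ s l = begin
    boxSum m ℓ (λ cs → value M (m , cs)) s
      ≡⟨ boxSum-antidiagonal m ℓ s _ (onZero (λ r _ → δ 0 r *ℤ δ m M)) l refl (λ c ℓ′ s′ _ _ _ → boxSum-zero (suc c) ℓ′ s′) ⟩
    antidiagonal (suc m) (onZero (λ r _ → δ 0 r *ℤ δ m M)) s
      ≡⟨ antidiagonal-onZero m _ s (λ _ _ → refl) ⟩
    δ 0 s *ℤ δ m M
      ≡⟨ initial s ⟩
    atZero (λ m → δ m M) s m ∎
    where
    open ≡-Reasoning
    initial : ∀ s → δ 0 s *ℤ δ m M ≡ atZero (λ m → δ m M) s m
    initial zero    = ℤₚ.*-identityˡ _
    initial (suc s) = refl
  boxSum-value (𝓔 ∷ ops) m ℓ s l =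
    boxSum-antidiagonal m ℓ s _ (count ops) l (nil-value ops s) (λ c ℓ′ s′ _ q _ → boxSum-value ops (suc c) ℓ′ s′ q)
  boxSum-value (𝓝 ∷ ops) zero    ℓ s l = trans (ℤₚ.+-identityʳ _) (nil-value ops s)
  boxSum-value (𝓝 ∷ ops) (suc m) ℓ s l = go (suc s) ℓ s ℕₚ.≤-refl l
    where
    -- Skipping a column changes neither the operators nor the height, only the weight, so the
    -- recursion runs on a bound `b` for the weight.
    go : ∀ b ℓ s → s < b → s ≤ ℓ → boxSum (suc m) ℓ (λ cs → value M (final (𝓝 ∷ ops) (suc m) cs)) s ≡ count (𝓝 ∷ ops) s (suc m)
    go (suc b) ℓ s s<b l = trans
      (boxSum-suc m ℓ s _ (λ r → count (𝓝 ∷ ops) r (suc m)) l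
        (λ ℓ′ s′ q s′<s → trans
          (boxSum-cong (suc m) ℓ′ s′ (λ cs → cong (value M) (final-skip ops (suc m) cs)))
          (go b ℓ′ s′ (ℕₚ.≤-trans s′<s (s≤s⁻¹ s<b)) q)))
      (trans
        (cong (_+ℤ shift (suc m) (λ r → count (𝓝 ∷ ops) r (suc m)) s)
          (boxSum-antidiagonal m ℓ s _ (count ops) l (nil-value ops s)
            (λ c ℓ′ s′ c<m q _ → trans
              (boxSum-cong (suc c) ℓ′ s′ (λ cs → cong (value M) (final-smaller ops cs (s≤s c<m))))
              (boxSum-value ops (suc c) ℓ′ s′ q))))
        (sym (transposeN-rec (count ops) s m)))

  -- The empty board gets 0 because zt/(1 - zt) has no constant term; otherwise that series has
  -- chosen the first column, at whose height the automaton starts.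
  columnsValue : List Op → List ℕ → ℤ
  columnsValue ops []       = 0ℤ
  columnsValue ops (c ∷ cs) = value M (final ops c cs)

  pairˢ-initial-count : ∀ ops N → pairˢ ((z^ 1 t^ 1) ⊛ (1/1-z^ 1 t^ 1)) (count ops) N ≡ boxSum N N (columnsValue ops) N
  pairˢ-initial-count ops zero    = pairˢ-initial-zero (count ops)
  pairˢ-initial-count ops (suc N) = begin
    X
      ≡⟨ sym (ℤₚ.+-identityʳ X) ⟩
    X +ℤ 0ℤ
      -- The added term is 0, since no columns at all cannot make up a positive weight.
      ≡⟨ cong (X +ℤ_) (nil-value ops (suc N)) ⟩
    X +ℤ count ops (suc N) 0
      ≡⟨ pairˢ-initial (count ops) (suc N) ⟩
    antidiagonal (suc (suc N)) (count ops) (suc N)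
      ≡⟨ sym (boxSum-antidiagonal (suc N) (suc N) (suc N) (columnsValue ops) (count ops) ℕₚ.≤-refl (nil-value ops (suc N))
           (λ c ℓ′ s′ _ q _ → boxSum-value ops (suc c) ℓ′ s′ q)) ⟩
    boxSum (suc N) (suc N) (columnsValue ops) (suc N) ∎
    where
    open ≡-Reasoning
    X = pairˢ ((z^ 1 t^ 1) ⊛ (1/1-z^ 1 t^ 1)) (count ops) (suc N)

-- Conjugation

-- The column heights: a new first row of length a puts a box on top of every column
-- and adds columns of height 1.
conj : List ℕ → List ℕ
conj []      = []
conj (a ∷ l) = map suc (conj l) ++ replicate (a ∸ length (conj l)) 1

head₀≤ : ∀ {a l} → Linked _≥_ (a ∷ l) → head₀ l ≤ a
head₀≤ [-]     = z≤n
head₀≤ (p ∷ _) = p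

length-conj : ∀ {l} → Linked _≥_ l → length (conj l) ≡ head₀ l
length-conj {[]}    d = refl
length-conj {a ∷ l} d = begin
  length (map suc (conj l) ++ replicate (a ∸ n) 1)          ≡⟨ length-++ (map suc (conj l)) ⟩
  length (map suc (conj l)) + length (replicate (a ∸ n) 1)  ≡⟨ cong₂ _+_ (length-map suc (conj l)) (length-replicate (a ∸ n)) ⟩
  n + (a ∸ n)                                               ≡⟨ ℕₚ.m+[n∸m]≡n (subst (_≤ a) (sym (length-conj (Linked.tail d))) (head₀≤ d)) ⟩
  a                                                         ∎
  where
  open ≡-Reasoning
  n = length (conj l)

length-conj≤ : ∀ {a l} → Linked _≥_ (a ∷ l) → length (conj l) ≤ a
length-conj≤ {a} d = subst (_≤ a) (sym (length-conj (Linked.tail d))) (head₀≤ d)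

sum-conj : ∀ {l} → Linked _≥_ l → sum (conj l) ≡ sum l
sum-conj {[]}    d = refl
sum-conj {a ∷ l} d = begin
  sum (map suc (conj l) ++ replicate (a ∸ n) 1)       ≡⟨ sum-++ (map suc (conj l)) _ ⟩
  sum (map suc (conj l)) + sum (replicate (a ∸ n) 1)  ≡⟨ cong₂ _+_ (sum-map-suc (conj l)) (sum-ones (a ∸ n)) ⟩
  (sum (conj l) + n) + (a ∸ n)                        ≡⟨ ℕₚ.+-assoc (sum (conj l)) n _ ⟩
  sum (conj l) + (n + (a ∸ n))                        ≡⟨ cong₂ _+_ (sum-conj (Linked.tail d)) (ℕₚ.m+[n∸m]≡n (length-conj≤ d)) ⟩
  sum l + a                                           ≡⟨ ℕₚ.+-comm (sum l) a ⟩
  a + sum l                                           ∎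
  where
  open ≡-Reasoning
  n = length (conj l)
  sum-ones : ∀ k → sum (replicate k 1) ≡ k
  sum-ones zero    = refl
  sum-ones (suc k) = cong suc (sum-ones k)
  sum-map-suc : ∀ xs → sum (map suc xs) ≡ sum xs + length xs
  sum-map-suc []       = refl
  sum-map-suc (x ∷ xs) rewrite sum-map-suc xs | ℕₚ.+-suc (x + sum xs) (length xs) =
    cong suc (sym (ℕₚ.+-assoc x (sum xs) (length xs)))

conj-positive : ∀ l → All (0 <_) (conj l)
conj-positive []      = []
conj-positive (a ∷ l) = Allₚ.++⁺ (Allₚ.map⁺ (All.universal (λ _ → s≤s z≤n) (conj l))) (Allₚ.replicate⁺ _ ℕₚ.≤-refl)

conj-decreasing : ∀ l → Linked _≥_ (conj l)
conj-decreasing []      = []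
conj-decreasing (a ∷ l) = padded (conj l) (a ∸ length (conj l)) (conj-decreasing l)
  where
  ones : ∀ k → Linked _≥_ (replicate k 1)
  ones zero          = []
  ones (suc zero)    = [-]
  ones (suc (suc k)) = ℕₚ.≤-refl ∷ ones (suc k)
  padded : ∀ xs k → Linked _≥_ xs → Linked _≥_ (map suc xs ++ replicate k 1)
  padded []           k       d       = ones k
  padded (x ∷ [])     zero    d       = [-]
  padded (x ∷ [])     (suc k) d       = s≤s z≤n ∷ ones (suc k)
  padded (x ∷ y ∷ xs) k       (p ∷ d) = s≤s p ∷ padded (y ∷ xs) k d

-- Dual to the definition of `conj`: a new first column becomes a new first row. Positivity excludes
-- the empty board, whose conjugate has no row.
conj-map-suc : ∀ l k → 0 < length l + k → conj (map suc l ++ replicate k 1) ≡ (length l + k) ∷ conj l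
conj-map-suc []          (suc zero)    p = refl
conj-map-suc []          (suc (suc k)) p rewrite conj-map-suc [] (suc k) (s≤s z≤n) = refl
conj-map-suc (a ∷ [])    zero          p = refl
conj-map-suc (a ∷ [])    (suc k)       p rewrite conj-map-suc [] (suc k) (s≤s z≤n) = refl
conj-map-suc (a ∷ b ∷ l) k             p rewrite conj-map-suc (b ∷ l) k (s≤s z≤n) = refl

conj-involutive : ∀ {l} → Linked _≥_ l → All (0 <_) l → conj (conj l) ≡ l
conj-involutive {[]}    d p        = refl
conj-involutive {a ∷ l} d (p ∷ ps) = trans
  (conj-map-suc (conj l) (a ∸ length (conj l)) (subst (0 <_) (sym q) p))
  (cong₂ _∷_ q (conj-involutive (Linked.tail d) ps))
  where
  q : length (conj l) + (a ∸ length (conj l)) ≡ a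
  q = ℕₚ.m+[n∸m]≡n (length-conj≤ d)

conjᴾ : Partition → Partition
conjᴾ α = mkPartition (conj (parts α)) (conj-decreasing (parts α)) (conj-positive (parts α))

conjᴾ-involutive : ∀ α → conjᴾ (conjᴾ α) ≡ α
conjᴾ-involutive α = partition-≡ (conj-involutive (decreasing α) (positive α))

∈-partitions-conj : ∀ {α N} → α ∈ partitions N → conjᴾ α ∈ partitions N
∈-partitions-conj {α} {N} i =
  subst (λ n → conjᴾ α ∈ partitions n) (trans (sum-conj (decreasing α)) (∈-partitions⁻ {n = N} i)) (∈-partitions⁺ (conjᴾ α))

-- Conjugation is an involution that preserves weight, and two duplicate-free lists with the same
-- elements are permutations of each other.
map-conjᴾ-↭ : ∀ N → map conjᴾ (partitions N) ↭ partitions N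
map-conjᴾ-↭ N = ∼bag⇒↭ (unique∧set⇒bag
  (Uniqueₚ.map⁺ injective (partitions-unique N)) (partitions-unique N) (mk⇔ to from))
  where
  injective : ∀ {α β} → conjᴾ α ≡ conjᴾ β → α ≡ β
  injective {α} {β} e = trans (sym (conjᴾ-involutive α)) (trans (cong conjᴾ e) (conjᴾ-involutive β))
  to : ∀ {α} → α ∈ map conjᴾ (partitions N) → α ∈ partitions N
  to {α} i with ∈-map⁻ conjᴾ i
  ... | β , j , refl = ∈-partitions-conj {β} {N} j
  from : ∀ {α} → α ∈ partitions N → α ∈ map conjᴾ (partitions N)
  from {α} i = subst (_∈ map conjᴾ (partitions N)) (conjᴾ-involutive α) (∈-map⁺ conjᴾ (∈-partitions-conj {α} {N} i))

sumOver-partitions : ∀ (f : List ℕ → ℤ) N → sumOver (f ∘ parts) (partitions N) ≡ boxSum N N f N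
sumOver-partitions f N = trans (selected (boxed N N)) (trans
  (sym (sumOver-map (λ l → δ (sum l) N *ℤ f l) parts (boxed N N)))
  (cong (sumOver (λ l → δ (sum l) N *ℤ f l)) (map-parts (box-sound N N))))
  where
  map-parts : ∀ {w ls} (bs : All (IsBoxed w) ls) → map parts (All.reduce toPartition bs) ≡ ls
  map-parts []       = refl
  map-parts (b ∷ bs) = cong (_ ∷_) (map-parts bs)

  selected : ∀ αs → sumOver (f ∘ parts) (filter (λ α → weight α ≟ N) αs) ≡ sumOver (λ α → δ (weight α) N *ℤ f (parts α)) αs
  selected αs = trans (sumOver-filter (λ α → weight α ≟ N) (f ∘ parts) αs)
    (sumOver-cong αs (λ α _ → cong (_*ℤ f (parts α)) (indicator-≟ (weight α) N)))

sumOver-conj : ∀ (f : List ℕ → ℤ) N → sumOver (f ∘ conj ∘ parts) (partitions N) ≡ boxSum N N f N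
sumOver-conj f N = trans (sym (sumOver-map (f ∘ parts) conjᴾ (partitions N)))
  (trans (sumOver-↭ (f ∘ parts) (map-conjᴾ-↭ N)) (sumOver-partitions f N))

coeff-applyAll : ∀ ops N M → coeff (applyAll ops ((z^ 1 t^ 1) ⊛ (1/1-z^ 1 t^ 1)) N) M
                           ≡ sumOver (columnsValue M ops ∘ conj ∘ parts) (partitions N)
coeff-applyAll ops N M = begin
  coeff (applyAll ops G N) M                       ≡⟨ sym (pairᴾ-coeff (applyAll ops G N) M) ⟩
  pairᴾ (applyAll ops G N) (λ i → δ i M)           ≡⟨ sym (pairˢ-atZero (applyAll ops G) (λ i → δ i M) N) ⟩
  pairˢ (applyAll ops G) (atZero (λ i → δ i M)) N  ≡⟨ pairˢ-applyAll ops G _ N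
                                                                     (λ f → pairˢ-initial-zero (atZero f)) ⟩
  pairˢ G (count M ops) N                                     ≡⟨ pairˢ-initial-count M ops N ⟩
  boxSum N N (columnsValue M ops) N                           ≡⟨ sym (sumOver-conj (columnsValue M ops) N) ⟩
  sumOver (columnsValue M ops ∘ conj ∘ parts) (partitions N)  ∎
  where
  open ≡-Reasoning
  G = (z^ 1 t^ 1) ⊛ (1/1-z^ 1 t^ 1)

-- Containment, column by column

-- Unlike in Contains, emptied rows are kept, so that a column can be removed
-- from both sides.
Selects : List ℕ → List ℕ → Set
Selects l ν = ∃ λ r → r ⊆ l × ∃ λ w → ∃ λ (C : Subset w) → map (deleteColumns C) r ≡ ν

deleteColumns-zero : ∀ {w} (C : Subset w) → deleteColumns C 0 ≡ 0
deleteColumns-zero []      = refl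
deleteColumns-zero (_ ∷ C) = refl

map-transfer : ∀ {f g h : ℕ → ℕ} {r ν} → (∀ a x → f a ≡ h x → g a ≡ x) → map f r ≡ map h ν → map g r ≡ ν
map-transfer {r = []}    {[]}    t e = refl
map-transfer {r = a ∷ r} {x ∷ ν} t e = cong₂ _∷_ (t a x (∷-injectiveˡ e)) (map-transfer t (∷-injectiveʳ e))

map-suc-⊆⁻ : ∀ l {r} → r ⊆ map suc l → ∃ λ r′ → r ≡ map suc r′ × r′ ⊆ l
map-suc-⊆⁻ []      []         = [] , refl , []
map-suc-⊆⁻ (x ∷ l) (_ ∷ʳ p)   with map-suc-⊆⁻ l p
... | r′ , e , q = r′ , e , x ∷ʳ q
map-suc-⊆⁻ (x ∷ l) (refl ∷ p) with map-suc-⊆⁻ l p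
... | r′ , e , q = x ∷ r′ , cong (suc x ∷_) e , refl ∷ q

⊆-without-zeros : ∀ l {k r} → r ⊆ l ++ replicate k 0 → All (0 <_) r → r ⊆ l
⊆-without-zeros []      {k} p          ps       = none (All-resp-⊆ p (Allₚ.replicate⁺ k refl)) ps
  where
  none : ∀ {r} → All (_≡ 0) r → All (0 <_) r → r ⊆ []
  none []         []       = []
  none (refl ∷ _) (() ∷ _)
⊆-without-zeros (x ∷ l)     (_ ∷ʳ p)   ps       = x ∷ʳ ⊆-without-zeros l p ps
⊆-without-zeros (x ∷ l)     (refl ∷ p) (_ ∷ ps) = refl ∷ ⊆-without-zeros l p ps

-- Deletes the first kept column too: every row with a box left reaches that column and loses
-- exactly one box.
dropColumn : ∀ {w} (C : Subset w) → ∃ λ (C′ : Subset w) → ∀ a x → deleteColumns C a ≡ suc x → deleteColumns C′ a ≡ x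
dropColumn []            = [] , λ _ _ ()
dropColumn (inside ∷ C)  with dropColumn C
... | C′ , t = inside ∷ C′ , λ { (suc a) x e → t a x e }
dropColumn (outside ∷ C) = inside ∷ C , λ { (suc a) x e → ℕₚ.suc-injective e }

-- The rows in question all contain the first kept column, which may therefore be
-- traded for column 1.
dropFirstColumn : ∀ {w} (C : Subset w) →
                  ∃ λ w′ → ∃ λ (C′ : Subset w′) → ∀ a x → deleteColumns C (suc a) ≡ suc x → deleteColumns C′ a ≡ x
dropFirstColumn []            = 0 , [] , λ _ _ ()
dropFirstColumn (inside ∷ C)  = _ , dropColumn C
dropFirstColumn (outside ∷ C) = _ , C , λ a x e → ℕₚ.suc-injective e

selects-suc⁺ : ∀ {l ν} → Selects l ν → Selects (map suc l) (map suc ν)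
selects-suc⁺ (r , p , w , C , refl) =
  map suc r , map⁺ suc p , suc w , outside ∷ C , trans (sym (map-∘ r)) (map-∘ r)

selects-suc⁻ : ∀ {l ν} → Selects (map suc l) (map suc ν) → Selects l ν
selects-suc⁻ {l} (r , p , w , C , e) with map-suc-⊆⁻ l p | dropFirstColumn C
... | r′ , refl , q | w′ , C′ , t = r′ , q , w′ , C′ , map-transfer t (trans (map-∘ r′) e)

-- The exchange for 𝓔: a pattern whose rows are all nonempty uses none of the `k` empty rows, and
-- its first column can be moved to the first column of the board.
selects-column : ∀ {l ν} k → Selects (map suc l ++ replicate k 0) (map suc ν) ⇔ Selects l ν
selects-column {l} {ν} k = mk⇔ to from
  where
  to : Selects (map suc l ++ replicate k 0) (map suc ν) → Selects l ν
  to (r , p , w , C , e) = selects-suc⁻ (r , ⊆-without-zeros (map suc l) p (positives r ν e) , w , C , e)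
    where
    positives : ∀ r ν → map (deleteColumns C) r ≡ map suc ν → All (0 <_) r
    positives []          ν       e = []
    positives (zero ∷ r)  (x ∷ ν) e = contradiction (trans (sym (deleteColumns-zero C)) (∷-injectiveˡ e)) λ ()
    positives (suc a ∷ r) (x ∷ ν) e = s≤s z≤n ∷ positives r ν (∷-injectiveʳ e)
  from : Selects l ν → Selects (map suc l ++ replicate k 0) (map suc ν)
  from s with selects-suc⁺ s
  ... | r , p , rest = r , ++⁺ʳ (replicate k 0) p , rest

selects-drop : ∀ {l ν x} → Selects l (ν ++ x ∷ []) → Selects l ν
selects-drop {ν = ν} {x} (r , p , w , C , e) =
  take (length ν) r , ⊆-trans (take-⊆ (length ν) r) p , w , C ,
  trans (sym (take-map (length ν) r)) (trans (cong (take (length ν)) e) (take-prefix ν))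
  where
  take-prefix : ∀ ν → take (length ν) (ν ++ x ∷ []) ≡ ν
  take-prefix []      = refl
  take-prefix (y ∷ ν) = cong (y ∷_) (take-prefix ν)

-- The exchange for 𝓝 at a shorter column: one of the empty rows below that column serves as the
-- empty last row of the pattern.
selects-column-row : ∀ {l ν} k → Selects (map suc l ++ replicate (suc k) 0) (map suc ν ++ 0 ∷ []) ⇔ Selects l ν
selects-column-row {l} {ν} k = mk⇔ (λ s → Equivalence.to (selects-column (suc k)) (selects-drop {ν = map suc ν} s)) from
  where
  from : Selects l ν → Selects (map suc l ++ replicate (suc k) 0) (map suc ν ++ 0 ∷ [])
  from s with selects-suc⁺ s
  ... | r , p , w , C , e = r ++ 0 ∷ [] , ++⁺ p (refl ∷ minimum (replicate k 0)) , w , C ,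
    trans (map-++ (deleteColumns C) r (0 ∷ [])) (cong₂ _++_ e (cong (_∷ []) (deleteColumns-zero C)))

-- When every row of the board meets the first column, keeping that column would leave no selected
-- row empty; as the pattern has an empty row, the column must be deleted.
selects-skip : ∀ {l ν} → Selects (map suc l) (ν ++ 0 ∷ []) ⇔ Selects l (ν ++ 0 ∷ [])
selects-skip {l} {ν} = mk⇔ to (λ { (r , p , w , C , e) → map suc r , map⁺ suc p , suc w , inside ∷ C , trans (sym (map-∘ r)) e })
  where
  to : Selects (map suc l) (ν ++ 0 ∷ []) → Selects l (ν ++ 0 ∷ [])
  to (r , p , w , C , e) with map-suc-⊆⁻ l p
  to (_ , p , w , []          , e) | r , refl , q = r , q , 0 , [] , trans (map-∘ r) e
  to (_ , p , w , inside ∷ C  , e) | r , refl , q = r , q , _ , C , trans (map-∘ r) e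
  to (_ , p , w , outside ∷ C , e) | r , refl , q = contradiction (Allₚ.++⁻ʳ ν (subst (All (0 <_)) e positives)) λ { (() ∷ _) }
    where
    positives : All (0 <_) (map (deleteColumns (outside ∷ C)) (map suc r))
    positives = Allₚ.map⁺ (Allₚ.map⁺ (All.universal (λ _ → s≤s z≤n) r))

¬selects-nil : ∀ {x ν} → ¬ Selects [] (x ∷ ν)
¬selects-nil (.[] , [] , _ , _ , ())

contains⇔selects : ∀ α μ → Contains α μ ⇔ Selects (parts α) (parts μ)
contains⇔selects α μ = mk⇔ to from
  where
  deleteRows-⊆ : ∀ l (R : Subset (length l)) → deleteRows l R ⊆ l
  deleteRows-⊆ []      []            = []
  deleteRows-⊆ (a ∷ l) (inside  ∷ R) = a ∷ʳ deleteRows-⊆ l R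
  deleteRows-⊆ (a ∷ l) (outside ∷ R) = refl ∷ deleteRows-⊆ l R

  ⊆-deleteRows : ∀ l {r} → r ⊆ l → ∃ λ R → deleteRows l R ≡ r
  ⊆-deleteRows []      []       = [] , refl
  ⊆-deleteRows (a ∷ l) (_ ∷ʳ p) with ⊆-deleteRows l p
  ... | R , e = inside ∷ R , e
  ⊆-deleteRows (a ∷ l) (refl ∷ p) with ⊆-deleteRows l p
  ... | R , e = outside ∷ R , cong (a ∷_) e

  -- Rows that the column deletion empties are deselected beforehand, which replaces the filtering
  -- in `remainder`.
  filter-map : ∀ {P : Pred ℕ 0ℓ} (P? : Decidable P) (f : ℕ → ℕ) l → ∃ λ r → r ⊆ l × map f r ≡ filter P? (map f l)
  filter-map P? f []      = [] , [] , refl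
  filter-map P? f (a ∷ l) with filter-map P? f l | P? (f a)
  ... | r , p , e | yes _ = a ∷ r , refl ∷ p , cong (f a ∷_) e
  ... | r , p , e | no  _ = r , a ∷ʳ p , e

  resize : ∀ {w} (C : Subset w) W → ∃ λ (C′ : Subset W) → ∀ a → a ≤ W → deleteColumns C′ a ≡ deleteColumns C a
  resize C       zero    = [] , λ { zero z≤n → sym (deleteColumns-zero C) }
  -- Columns beyond the width of the subset count as deleted, hence `inside`.
  resize []      (suc W) with resize [] W
  ... | C′ , t = inside ∷ C′ , λ { zero _ → refl ; (suc a) (s≤s l) → t a l }
  resize (b ∷ C) (suc W) with resize C W
  resize (inside  ∷ C) (suc W) | C′ , t = inside ∷ C′ , λ { zero _ → refl ; (suc a) (s≤s l) → t a l }
  resize (outside ∷ C) (suc W) | C′ , t = outside ∷ C′ , λ { zero _ → refl ; (suc a) (s≤s l) → cong suc (t a l) }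

  ≤largest : ∀ {l} → Linked _≥_ l → All (_≤ head₀ l) l
  ≤largest []      = []
  ≤largest [-]     = ℕₚ.≤-refl ∷ []
  ≤largest (p ∷ d) = ℕₚ.≤-refl ∷ All.map (λ q → ℕₚ.≤-trans q p) (≤largest d)

  to : Contains α μ → Selects (parts α) (parts μ)
  to (R , C , e) with filter-map (0 <?_) (deleteColumns C) (deleteRows (parts α) R)
  ... | r , p , q = r , ⊆-trans p (deleteRows-⊆ (parts α) R) , _ , C , trans q e

  from : Selects (parts α) (parts μ) → Contains α μ
  from (r , p , w , C , e) with ⊆-deleteRows (parts α) p | resize C (largest α)
  ... | R , refl | C′ , t = R , C′ , trans (cong (filter (0 <?_)) e′) (filter-all (0 <?_) (positive μ))
    where
    e′ : map (deleteColumns C′) (deleteRows (parts α) R) ≡ parts μ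
    e′ = trans (map-cong-local (All.map (λ {a} → t a) (All-resp-⊆ p (≤largest (decreasing α))))) e

-- The row lengths of the board with columns cs, together with empty rows up to a
-- total of m.
rows : ℕ → List ℕ → List ℕ
rows m []       = replicate m 0
rows m (c ∷ cs) = map suc (rows c cs) ++ replicate (m ∸ c) 0

conj-rows : ∀ {c cs} → Linked _≥_ (c ∷ cs) → conj (c ∷ cs) ≡ map suc (rows c cs)
conj-rows {c} {[]}      d       = sym (map-replicate suc c 0)
conj-rows {c} {c′ ∷ cs} (p ∷ d) rewrite length-conj d | conj-rows d = sym (trans
  (map-++ suc (map suc (rows c′ cs)) (replicate (c ∸ c′) 0))
  (cong (map suc (map suc (rows c′ cs)) ++_) (map-replicate suc (c ∸ c′) 0)))

-- The automaton decides containment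

Valid : ℕ × List ℕ → Set
Valid (m , cs) = Linked _≥_ (m ∷ cs) × All (0 <_) cs

final-nil : ∀ ops → final ops 0 [] ≡ (0 , [])
final-nil []        = refl
final-nil (𝓔 ∷ ops) = final-nil ops
final-nil (𝓝 ∷ ops) = final-nil ops

final-valid : ∀ ops m cs → Valid (m , cs) → Valid (final ops m cs)
final-valid []        m cs       v = v
final-valid (𝓔 ∷ ops) m []       v = final-valid ops 0 [] ([-] , [])
final-valid (𝓔 ∷ ops) m (c ∷ cs) (_ ∷ d , _ ∷ ps) = final-valid ops c cs (d , ps)
final-valid (𝓝 ∷ ops) m []       v = final-valid ops 0 [] ([-] , [])
final-valid (𝓝 ∷ ops) m (c ∷ cs) (c≤m ∷ d , _ ∷ ps) with ℕₚ.m≤n⇒m<n∨m≡n c≤m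
... | inj₁ c<m  = subst Valid (sym (final-smaller ops cs c<m)) (final-valid ops c cs (d , ps))
... | inj₂ refl = subst Valid (sym (final-skip ops m cs)) (final-valid (𝓝 ∷ ops) m cs (d , ps))

-- The pattern whose border consists of the steps ops followed by the border of base.
pat : List ℕ → List Op → List ℕ
pat base []        = base
pat base (𝓔 ∷ ops) = map suc (pat base ops)
pat base (𝓝 ∷ ops) = map suc (pat base ops) ++ 0 ∷ []

pat-cons : ∀ x base ops → pat (x ∷ base) ops ≡ (length ops + x) ∷ pat base ops
pat-cons x base []        = refl
pat-cons x base (𝓔 ∷ ops) rewrite pat-cons x base ops = refl
pat-cons x base (𝓝 ∷ ops) rewrite pat-cons x base ops = refl

-- The invariant of the automaton: an operator strips its step from the pattern and columns from the
-- board, by `selects-column`, `selects-column-row` and `selects-skip`. The explicit `x` guarantees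
-- that the pattern has a row.
selects-final : ∀ x base ops m cs → Valid (m , cs) →
  Selects (rows m cs) (pat (x ∷ base) ops) ⇔ Selects (rows (proj₁ (final ops m cs)) (proj₂ (final ops m cs))) (x ∷ base)
selects-final x base []        m cs       v = ⇔-id _
selects-final x base (𝓔 ∷ ops) m []       v = selects-final x base ops 0 [] ([-] , []) ⇔-∘ selects-column m
selects-final x base (𝓔 ∷ ops) m (c ∷ cs) (_ ∷ d , _ ∷ ps) =
  selects-final x base ops c cs (d , ps) ⇔-∘ selects-column (m ∸ c)
-- A board without rows contains no pattern that has a row, so both sides are false.
selects-final x base (𝓝 ∷ ops) zero    [] v rewrite final-nil ops =
  mk⇔ (λ s → contradiction (selects-drop {ν = map suc (pat (x ∷ base) ops)} s) none)
      (λ s → contradiction s ¬selects-nil)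
  where
  none : ¬ Selects [] (map suc (pat (x ∷ base) ops))
  none s rewrite pat-cons x base ops = ¬selects-nil s
selects-final x base (𝓝 ∷ ops) (suc m) [] v = selects-final x base ops 0 [] ([-] , []) ⇔-∘ selects-column-row m
selects-final x base (𝓝 ∷ ops) m (c ∷ cs) (c≤m ∷ d , _ ∷ ps) with ℕₚ.m≤n⇒m<n∨m≡n c≤m
-- A shorter column means `m ∸ c` is a successor: there is an empty row to spare.
... | inj₁ c<m  rewrite final-smaller ops cs c<m | sym (ℕₚ.suc-pred (m ∸ c) {{>-nonZero (ℕₚ.m<n⇒0<n∸m c<m)}}) =
  selects-final x base ops c cs (d , ps) ⇔-∘ selects-column-row _
... | inj₂ refl rewrite final-skip ops m cs | ℕₚ.n∸n≡0 m | ++-identityʳ (map suc (rows m cs)) =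
  selects-final x base (𝓝 ∷ ops) m cs (d , ps) ⇔-∘ selects-skip {ν = map suc (pat (x ∷ base) ops)}

selects-zero : ∀ {l} → (∃ λ a → ∃ λ l′ → l ≡ a ∷ l′) → Selects l (0 ∷ [])
selects-zero (a , l , refl) = a ∷ [] , refl ∷ minimum l , 0 , [] , refl

rows-nonempty : ∀ m cs → Valid (suc m , cs) → ∃ λ a → ∃ λ l → rows (suc m) cs ≡ a ∷ l
rows-nonempty m []           v = _ , _ , refl
rows-nonempty m (suc c ∷ cs) (_ ∷ d , _ ∷ ps) with rows-nonempty c cs (d , ps)
... | a , l , e rewrite e = _ , _ , refl
rows-nonempty m (zero ∷ cs)  (_ , () ∷ _)

-- Once the word is read, `0 ∷ []` is what remains of τ and asks for a row, that is m > 0; `1 ∷ []`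
-- is what remains of μ and asks for a further column.
data Outcome (m : ℕ) (cs : List ℕ) : Set where
  stops     : m ≡ 0 → cs ≡ [] → ¬ Selects (rows m cs) (0 ∷ []) → ¬ Selects (rows m cs) (1 ∷ []) → Outcome m cs
  completes : 0 < m → cs ≡ [] → Selects (rows m cs) (0 ∷ []) → ¬ Selects (rows m cs) (1 ∷ []) → Outcome m cs
  continues : ∀ {c cs′} → cs ≡ c ∷ cs′ → Selects (rows m cs) (0 ∷ []) → Selects (rows m cs) (1 ∷ []) → Outcome m cs

outcome : ∀ m cs → Valid (m , cs) → Outcome m cs
outcome zero    []       v = stops refl refl ¬selects-nil ¬selects-nil
outcome zero    (c ∷ cs) (c≤0 ∷ _ , 0<c ∷ _) = contradiction (ℕₚ.≤-trans 0<c c≤0) λ ()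
outcome (suc m) []       v = completes (s≤s z≤n) refl (selects-zero (rows-nonempty m [] v))
  (λ s → ¬selects-nil (Equivalence.to (selects-column {[]} {0 ∷ []} (suc m)) s))
outcome (suc m) (suc c ∷ cs) v@(_ ∷ d , _ ∷ ps) = continues refl
  (selects-zero (rows-nonempty m (suc c ∷ cs) v))
  (Equivalence.from (selects-column (m ∸ c)) (selects-zero (rows-nonempty c cs (d , ps))))
outcome (suc m) (zero ∷ cs) (_ , () ∷ _)

-- The multiplicity of the largest part

tops : List ℕ → ℕ
tops l = length (filter (_≟ head₀ l) l)

tops-zeros : ∀ m → tops (replicate m 0) ≡ m
tops-zeros zero = refl
tops-zeros (suc m) = cong suc (go m)
  where
  go : ∀ m → length (filter (_≟ 0) (replicate m 0)) ≡ m
  go zero = refl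
  go (suc m) = cong suc (go m)

-- The hypothesis excludes the empty list, for which the added zeros would themselves be the longest
-- rows.
tops-suc : ∀ l k {j} → tops l ≡ suc j → tops (map suc l ++ replicate k 0) ≡ suc j
tops-suc (a ∷ l) k e = trans (go (a ∷ l)) e
  where
  go : ∀ xs → length (filter (_≟ suc a) (map suc xs ++ replicate k 0)) ≡ length (filter (_≟ a) xs)
  go (x ∷ xs) with does (x ≟ a)
  ... | true  = cong suc (go xs)
  ... | false = go xs
  go [] = zeros k
    where
    zeros : ∀ k → length (filter (_≟ suc a) (replicate k 0)) ≡ 0
    zeros zero    = refl
    zeros (suc k) = zeros k

-- Removing a column keeps the number of longest rows, until after the last column all remaining
-- rows are equal. A positive final height excludes missing columns.
tops-final : ∀ ops m cs {j} → Valid (m , cs) → final ops m cs ≡ (suc j , []) → tops (rows m cs) ≡ suc j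
tops-final []        m .[]       v refl = tops-zeros m
tops-final (𝓔 ∷ ops) m []       v e = contradiction (trans (sym (final-nil ops)) e) λ ()
tops-final (𝓔 ∷ ops) m (c ∷ cs) (_ ∷ d , _ ∷ ps) e = tops-suc (rows c cs) (m ∸ c) (tops-final ops c cs (d , ps) e)
tops-final (𝓝 ∷ ops) m []       v e = contradiction (trans (sym (final-nil ops)) e) λ ()
tops-final (𝓝 ∷ ops) m (c ∷ cs) (c≤m ∷ d , _ ∷ ps) e with ℕₚ.m≤n⇒m<n∨m≡n c≤m
... | inj₁ c<m  = tops-suc (rows c cs) (m ∸ c) (tops-final ops c cs (d , ps) (trans (sym (final-smaller ops cs c<m)) e))
... | inj₂ refl = tops-suc (rows c cs) (m ∸ c) (tops-final (𝓝 ∷ ops) c cs (d , ps) (trans (sym (final-skip ops m cs)) e))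

-- The word of a super-strict partition

pat-++ : ∀ base ops ops′ → pat base (ops ++ ops′) ≡ pat (pat base ops′) ops
pat-++ base []        ops′ = refl
pat-++ base (𝓔 ∷ ops) ops′ = cong (map suc) (pat-++ base ops ops′)
pat-++ base (𝓝 ∷ ops) ops′ = cong (λ l → map suc l ++ 0 ∷ []) (pat-++ base ops ops′)

pat-east : ∀ x k → pat (x ∷ []) (replicate k 𝓔) ≡ (k + x) ∷ []
pat-east x zero    = refl
pat-east x (suc k) = cong (map suc) (pat-east x k)

pat-newRow : ∀ x k ops → pat (x ∷ []) (ops ++ 𝓝 ∷ replicate k 𝓔) ≡ (length ops + suc (k + x)) ∷ pat (0 ∷ []) ops
pat-newRow x k ops = begin
  pat (x ∷ []) (ops ++ 𝓝 ∷ replicate k 𝓔)                     ≡⟨ pat-++ (x ∷ []) ops _ ⟩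
  pat (map suc (pat (x ∷ []) (replicate k 𝓔)) ++ 0 ∷ []) ops  ≡⟨ cong (λ l → pat (map suc l ++ 0 ∷ []) ops) (pat-east x k) ⟩
  pat (suc (k + x) ∷ 0 ∷ []) ops                              ≡⟨ pat-cons (suc (k + x)) (0 ∷ []) ops ⟩
  (length ops + suc (k + x)) ∷ pat (0 ∷ []) ops               ∎
  where open ≡-Reasoning

addRow : ∀ {a b l ops} x → pat (0 ∷ []) ops ≡ b ∷ l → suc b + x ≤ a → ∃ λ ops′ → pat (x ∷ []) ops′ ≡ a ∷ b ∷ l
addRow {a} {b} {l} {ops} x e le = ops ++ 𝓝 ∷ replicate k 𝓔 , trans (pat-newRow x k ops) (cong₂ _∷_ first e)
  where
  open ≡-Reasoning
  -- Of the columns by which the new row exceeds the one below, one belongs to 𝓝 and `x` to the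
  -- base; the rest are east steps.
  k = a ∸ (suc b + x)
  b≡ : length ops + 0 ≡ b
  b≡ = ∷-injectiveˡ (trans (sym (pat-cons 0 [] ops)) e)
  first : length ops + suc (k + x) ≡ a
  first = begin
    length ops + suc (k + x)  ≡⟨ cong (_+ suc (k + x)) (trans (sym (ℕₚ.+-identityʳ _)) b≡) ⟩
    b + suc (k + x)           ≡⟨ ℕₚ.+-suc b (k + x) ⟩
    suc (b + (k + x))         ≡⟨ cong (λ y → suc (b + y)) (ℕₚ.+-comm k x) ⟩
    suc (b + (x + k))         ≡⟨ cong suc (sym (ℕₚ.+-assoc b x k)) ⟩
    suc b + x + k             ≡⟨ ℕₚ.m+[n∸m]≡n le ⟩
    a                         ∎

strict-word : ∀ a l → Linked (λ a b → suc b ≤ a) (a ∷ l) → ∃ λ ops → pat (0 ∷ []) ops ≡ a ∷ l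
strict-word a []      d       = replicate a 𝓔 , trans (pat-east 0 a) (cong (_∷ []) (ℕₚ.+-identityʳ a))
strict-word a (b ∷ l) (p ∷ d) with strict-word b l d
... | ops , e = addRow {ops = ops} 0 e (subst (_≤ a) (sym (ℕₚ.+-identityʳ (suc b))) p)

-- A gap of at least 2 leaves room for the last east step, which Θ ignores.
superStrict-word : ∀ a l → 0 < a → Linked (λ a b → 2 + b ≤ a) (a ∷ l) → ∃ λ ops → pat (1 ∷ []) ops ≡ a ∷ l
superStrict-word (suc a) []      _ d       = replicate a 𝓔 , trans (pat-east 1 a) (cong (_∷ []) (ℕₚ.+-comm a 1))
superStrict-word a       (b ∷ l) _ (p ∷ d) with strict-word b l (Linked.map ℕₚ.<⇒≤ d)
... | ops , e = addRow {ops = ops} 1 e (subst (_≤ a) (cong suc (ℕₚ.+-comm 1 b)) p)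

borderOf-suc : ∀ a l → borderOf (map suc (a ∷ l)) ≡ east ∷ borderOf (a ∷ l)
borderOf-suc a []      = refl
borderOf-suc a (b ∷ l) = cong (_++ replicate (a ∸ b) east ++ north ∷ []) (borderOf-suc b l)

borderOf-zero : ∀ l → borderOf (l ++ 0 ∷ []) ≡ north ∷ borderOf l
borderOf-zero []          = refl
borderOf-zero (a ∷ [])    = refl
borderOf-zero (a ∷ b ∷ l) = cong (_++ replicate (a ∸ b) east ++ north ∷ []) (borderOf-zero (b ∷ l))

borderOf-𝓔 : ∀ ops → borderOf (map suc (pat (1 ∷ []) ops)) ≡ east ∷ borderOf (pat (1 ∷ []) ops)
borderOf-𝓔 ops rewrite pat-cons 1 [] ops = borderOf-suc (length ops + 1) (pat [] ops)

borderOf-𝓝 : ∀ ops → borderOf (pat (1 ∷ []) (𝓝 ∷ ops)) ≡ north ∷ east ∷ borderOf (pat (1 ∷ []) ops)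
borderOf-𝓝 ops = trans (borderOf-zero (map suc (pat (1 ∷ []) ops))) (cong (north ∷_) (borderOf-𝓔 ops))

readSteps-pat : ∀ ops → readSteps (borderOf (pat (1 ∷ []) ops)) ≡ ops
readSteps-pat []        = refl
readSteps-pat (𝓔 ∷ ops) = begin
  readSteps (borderOf (map suc (pat (1 ∷ []) ops)))  ≡⟨ cong readSteps (borderOf-𝓔 ops) ⟩
  readSteps (east ∷ borderOf (pat (1 ∷ []) ops))     ≡⟨ readSteps-east _ (long ops) ⟩
  𝓔 ∷ readSteps (borderOf (pat (1 ∷ []) ops))        ≡⟨ cong (𝓔 ∷_) (readSteps-pat ops) ⟩
  𝓔 ∷ ops                                            ∎
  where
  open ≡-Reasoning
  readSteps-east : ∀ s → 1 < length s → readSteps (east ∷ s) ≡ 𝓔 ∷ readSteps s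
  readSteps-east (east  ∷ _ ∷ _) _ = refl
  readSteps-east (north ∷ _ ∷ _) _ = refl
  readSteps-east (_ ∷ [])        (s≤s ())

  -- At least two steps always follow, so the clause of `readSteps` for a closing east and north
  -- step is reached only at the very end.
  long : ∀ ops → 1 < length (borderOf (pat (1 ∷ []) ops))
  long []        = s≤s (s≤s z≤n)
  long (𝓔 ∷ ops) rewrite borderOf-𝓔 ops = ℕₚ.m≤n⇒m≤1+n (long ops)
  long (𝓝 ∷ ops) rewrite borderOf-𝓝 ops = s≤s (s≤s z≤n)
readSteps-pat (𝓝 ∷ ops) = trans (cong readSteps (borderOf-𝓝 ops)) (cong (𝓝 ∷_) (readSteps-pat ops))

-- The outer `map suc` is the initial east step and the box of `1 ∷ []` the final one, the two that
-- Θ ignores. Lowering all parts by one may turn the last into 0, which patterns allow.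
word : ∀ l → Linked _≥_ l → All (0 <_) l → AllPairs (λ a b → 2 ≤ ∣ a - b ∣) l → 2 ≤ sum l →
       ∃ λ ops → l ≡ map suc (pat (1 ∷ []) ops)
word (suc a ∷ []) d p ss w with superStrict-word a [] (s≤s⁻¹ (subst (2 ≤_) (ℕₚ.+-identityʳ (suc a)) w)) [-]
... | ops , e = ops , cong (map suc) (sym e)
word (suc a ∷ suc b ∷ l) d (_ ∷ ps) ss w = lower ps gaps
  where
  gaps : Linked (λ a b → 2 + b ≤ a) (suc a ∷ suc b ∷ l)
  gaps = go d ss
    where
    go : ∀ {l} → Linked _≥_ l → AllPairs (λ a b → 2 ≤ ∣ a - b ∣) l → Linked (λ a b → 2 + b ≤ a) l
    go []      _              = []
    go [-]     _              = [-]
    go (p ∷ d) ((q ∷ _) ∷ qs) =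
      ℕₚ.m≤o∸n⇒m+n≤o 2 p (subst (2 ≤_) (ℕₚ.m≤n⇒∣n-m∣≡n∸m p) q) ∷ go d qs

  lower : All (0 <_) (suc b ∷ l) → Linked (λ a b → 2 + b ≤ a) (suc a ∷ suc b ∷ l) →
          ∃ λ ops → suc a ∷ suc b ∷ l ≡ map suc (pat (1 ∷ []) ops)
  lower ps (q ∷ g) with superStrict-word a (b ∷ map pred l) (ℕₚ.≤-trans (s≤s z≤n) (s≤s⁻¹ q)) (s≤s⁻¹ q ∷ preds ps g)
    where
    preds : ∀ {b l} → All (0 <_) (suc b ∷ l) → Linked (λ a b → 2 + b ≤ a) (suc b ∷ l) → Linked (λ a b → 2 + b ≤ a) (b ∷ map pred l)
    preds (_ ∷ [])             [-]     = [-]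
    preds {l = suc c ∷ _} (_ ∷ ps) (q ∷ g) = s≤s⁻¹ q ∷ preds ps g
    preds {l = zero ∷ _} (_ ∷ () ∷ _) _
  ... | ops , e = ops , trans (cong (λ l → suc a ∷ suc b ∷ l) (sym (suc-pred l (All.tail ps)))) (cong (map suc) (sym e))
    where
    suc-pred : ∀ l → All (0 <_) l → map suc (map pred l) ≡ l
    suc-pred l ps = trans (sym (map-∘ l)) (map-id-local (All.map (λ { {suc _} _ → refl }) ps))
word (zero ∷ _) d (() ∷ _) ss w
word (suc _ ∷ zero ∷ _) d (_ ∷ () ∷ _) ss w

parts-decrementFirst : ∀ μ ss w → parts (decrementFirst μ ss w) ≡ (head₀ (parts μ) ∸ 1) ∷ drop 1 (parts μ)
parts-decrementFirst (mkPartition [] _ _) _ ()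
parts-decrementFirst (mkPartition (a ∷ []) _ _) _ _ = refl
parts-decrementFirst (mkPartition (a ∷ b ∷ l) (_ ∷ _) (_ ∷ _ ∷ _)) ((_ ∷ _) ∷ _) _ = refl

-- The box of the base `1 ∷ []` lies in the first row; removing it lowers μ₁ alone, so one word, and
-- hence one run of the automaton, serves both τ and μ.
Θ-word : ∀ μ ss w → parts μ ≡ map suc (pat (1 ∷ []) (Θ μ)) × parts (decrementFirst μ ss w) ≡ map suc (pat (0 ∷ []) (Θ μ))
Θ-word μ ss w with word (parts μ) (decreasing μ) (positive μ) ss w
... | ops , e = subst (λ ops → parts μ ≡ map suc (pat (1 ∷ []) ops)) (sym Θ≡) e , (begin
  parts (decrementFirst μ ss w)                ≡⟨ parts-decrementFirst μ ss w ⟩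
  (head₀ (parts μ) ∸ 1) ∷ drop 1 (parts μ)     ≡⟨ cong (λ l → (head₀ l ∸ 1) ∷ drop 1 l) (trans e (cong (map suc) (pat-cons 1 [] ops))) ⟩
  (length ops + 1) ∷ map suc (pat [] ops)      ≡⟨ cong (_∷ map suc (pat [] ops)) (ℕₚ.+-suc (length ops) 0) ⟩
  suc (length ops + 0) ∷ map suc (pat [] ops)  ≡⟨ cong (map suc) (sym (pat-cons 0 [] ops)) ⟩
  map suc (pat (0 ∷ []) ops)                   ≡⟨ cong (map suc ∘ pat (0 ∷ [])) (sym Θ≡) ⟩
  map suc (pat (0 ∷ []) (Θ μ))                 ∎)
  where
  open ≡-Reasoning
  Θ≡ : Θ μ ≡ ops
  Θ≡ = trans (cong (readSteps ∘ dropInitialEast ∘ borderOf) e)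
         (trans (cong (readSteps ∘ dropInitialEast) (borderOf-𝓔 ops)) (readSteps-pat ops))

-- Generating functions as sums over partitions

pairᴾ-F : ∀ {S : Pred Partition 0ℓ} (S? : Decidable S) f n →
         pairᴾ (F[ S? ] n) f ≡ sumOver (λ α → indicator (S? α) *ℤ f (multiplicity α)) (partitions n)
pairᴾ-F S? f n = trans (go (filter S? (partitions n))) (sumOver-filter S? (f ∘ multiplicity) (partitions n))
  where
  go : ∀ αs → pairᴾ (∑ (map (λ α → t^ multiplicity α) αs)) f ≡ sumOver (f ∘ multiplicity) αs
  go []       = refl
  go (α ∷ αs) = trans (pairᴾ-+ᴾ (t^ multiplicity α) _ f) (cong₂ _+ℤ_ (pairᴾ-t^ (multiplicity α) f) (go αs))

pairᴾ-at-t=1 : ∀ G f n → pairᴾ (at-t=1 G n) f ≡ pairᴾ (G n) (λ _ → f 0)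
pairᴾ-at-t=1 G f n = trans (ℤₚ.+-identityʳ _) (sym (pairᴾ-const (G n) (f 0)))

module _ (μ : Partition) (ss : SuperStrict μ) (w : 2 ≤ weight μ) where

  private
    τ = decrementFirst μ ss w
    ops = Θ μ
    ΘG = applyAll ops ((z^ 1 t^ 1) ⊛ (1/1-z^ 1 t^ 1))
    H = at-t=1 (F τ) ⊕ F₂ τ μ

  pairᴾ-H : ∀ f n → pairᴾ (H n) f ≡
           sumOver (λ α → indicator (positiveAv? τ α) *ℤ f 0 +ℤ indicator (𝒬? τ μ α) *ℤ f (multiplicity α)) (partitions n)
  pairᴾ-H f n = trans (pairᴾ-+ᴾ (at-t=1 (F τ) n) (F₂ τ μ n) f)
    (trans (cong₂ _+ℤ_ (trans (pairᴾ-at-t=1 (F τ) f n) (pairᴾ-F (positiveAv? τ) (λ _ → f 0) n)) (pairᴾ-F (𝒬? τ μ) f n))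
           (sym (sumOver-+ (λ α → indicator (positiveAv? τ α) *ℤ f 0) (λ α → indicator (𝒬? τ μ α) *ℤ f (multiplicity α)) (partitions n))))

  -- Classification of partitions by the final state

  data Kind (α : Partition) : List ℕ → Set where
    empty  : ¬ (0 < weight α) → Kind α []
    avoidτ : ∀ {c cs} → 0 < weight α → final ops c cs ≡ (0 , []) → Avoids α τ → Avoids α μ → Kind α (c ∷ cs)
    between : ∀ {c cs} → 0 < weight α → final ops c cs ≡ (multiplicity α , []) → Contains α τ → Avoids α μ → Kind α (c ∷ cs)
    containμ : ∀ {c cs m′ c′ cs′} → 0 < weight α → final ops c cs ≡ (m′ , c′ ∷ cs′) → Contains α τ → Contains α μ → Kind α (c ∷ cs)

  kind : ∀ α → Kind α (conj (parts α))
  kind α = go (conj (parts α)) refl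
    where
    αᶜ≡ : conj (conj (parts α)) ≡ parts α
    αᶜ≡ = conj-involutive (decreasing α) (positive α)

    go : ∀ cs → conj (parts α) ≡ cs → Kind α cs
    go []       e = empty (λ p → contradiction (subst (λ l → 0 < sum l) (trans (sym αᶜ≡) (cong conj e)) p) λ ())
    go (c ∷ cs) e = result (outcome m′ cs′ (final-valid ops c cs valid))
      where
      m′ = proj₁ (final ops c cs)
      cs′ = proj₂ (final ops c cs)

      d : Linked _≥_ (c ∷ cs)
      d = subst (Linked _≥_) e (conj-decreasing (parts α))
      p : All (0 <_) (c ∷ cs)
      p = subst (All (0 <_)) e (conj-positive (parts α))
      valid : Valid (c , cs)
      valid = d , All.tail p

      α≡ : parts α ≡ map suc (rows c cs)
      α≡ = trans (sym αᶜ≡) (trans (cong conj e) (conj-rows d))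

      0<weight : 0 < weight α
      0<weight = subst (0 <_) (trans (cong sum (sym e)) (sum-conj (decreasing α))) (ℕₚ.≤-trans (All.head p) (ℕₚ.m≤m+n c (sum cs)))

      contains : ∀ x ν → parts ν ≡ map suc (pat (x ∷ []) ops) → Contains α ν ⇔ Selects (rows m′ cs′) (x ∷ [])
      contains x ν e = selects-final x [] ops c cs valid ⇔-∘ mk⇔
        (λ k → selects-suc⁻ (subst₂ Selects α≡ e (Equivalence.to (contains⇔selects α ν) k)))
        (λ s → Equivalence.from (contains⇔selects α ν) (subst₂ Selects (sym α≡) (sym e) (selects-suc⁺ s)))

      μ⇔ : Contains α μ ⇔ Selects (rows m′ cs′) (1 ∷ [])
      μ⇔ = contains 1 μ (proj₁ (Θ-word μ ss w))
      τ⇔ : Contains α τ ⇔ Selects (rows m′ cs′) (0 ∷ [])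
      τ⇔ = contains 0 τ (proj₂ (Θ-word μ ss w))

      multiplicity≡ : ∀ {j} → final ops c cs ≡ (suc j , []) → multiplicity α ≡ suc j
      multiplicity≡ f = trans (cong tops (trans α≡ (sym (++-identityʳ _)))) (tops-suc (rows c cs) 0 (tops-final ops c cs valid f))

      result : Outcome m′ cs′ → Kind α (c ∷ cs)
      result (stops m′≡ cs′≡ ¬τ ¬μ) = avoidτ 0<weight (cong₂ _,_ m′≡ cs′≡) (¬τ ∘ Equivalence.to τ⇔) (¬μ ∘ Equivalence.to μ⇔)
      result (completes 0<m′ cs′≡ t ¬μ) = between 0<weight (mult (final ops c cs) refl 0<m′ cs′≡) (Equivalence.from τ⇔ t) (¬μ ∘ Equivalence.to μ⇔)
        where
        mult : ∀ f → final ops c cs ≡ f → 0 < proj₁ f → proj₂ f ≡ [] → final ops c cs ≡ (multiplicity α , [])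
        mult (suc j , []) f _ refl = trans f (cong (_, []) (sym (multiplicity≡ f)))
      result (continues cs′≡ t m) = containμ 0<weight (cong (m′ ,_) cs′≡) (Equivalence.from τ⇔ t) (Equivalence.from μ⇔ m)

  kind-value : ∀ {α cs} → Kind α cs → ∀ M →
    columnsValue M ops cs ≡ indicator (positiveAv? τ α) *ℤ δ 0 M +ℤ indicator (𝒬? τ μ α) *ℤ δ (multiplicity α) M
  kind-value {α} (empty w≡0) M
    rewrite indicator-no (positiveAv? τ α) (w≡0 ∘ proj₁) | indicator-no (𝒬? τ μ α) (w≡0 ∘ proj₁) = refl
  kind-value {α} (avoidτ p f ¬τ ¬μ) M
    rewrite f | indicator-yes (positiveAv? τ α) (p , ¬τ) | indicator-no (𝒬? τ μ α) (¬τ ∘ proj₁ ∘ proj₂) =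
    sym (trans (ℤₚ.+-identityʳ _) (ℤₚ.*-identityˡ _))
  kind-value {α} (between p f t ¬μ) M
    rewrite f | indicator-no (positiveAv? τ α) (λ q → proj₂ q t) | indicator-yes (𝒬? τ μ α) (p , t , ¬μ) =
    sym (trans (ℤₚ.+-identityˡ _) (ℤₚ.*-identityˡ _))
  kind-value {α} (containμ p f t m) M
    rewrite f | indicator-no (positiveAv? τ α) (λ q → proj₂ q t) | indicator-no (𝒬? τ μ α) (λ q → proj₂ (proj₂ q) m) = refl

  -- The μ-avoiders split into τ-avoiders and members of 𝒬 τ μ; that avoiding τ forces avoiding μ is
  -- read off the final state.
  kind-μ : ∀ {α cs} → Kind α cs → indicator (positiveAv? τ α) *ℤ 1ℤ +ℤ indicator (𝒬? τ μ α) *ℤ 1ℤ ≡ indicator (positiveAv? μ α) *ℤ 1ℤ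
  kind-μ {α} (empty w≡0)
    rewrite indicator-no (positiveAv? τ α) (w≡0 ∘ proj₁) | indicator-no (𝒬? τ μ α) (w≡0 ∘ proj₁)
          | indicator-no (positiveAv? μ α) (w≡0 ∘ proj₁) = refl
  kind-μ {α} (avoidτ p f ¬τ ¬μ)
    rewrite indicator-yes (positiveAv? τ α) (p , ¬τ) | indicator-no (𝒬? τ μ α) (¬τ ∘ proj₁ ∘ proj₂)
          | indicator-yes (positiveAv? μ α) (p , ¬μ) = refl
  kind-μ {α} (between p f t ¬μ)
    rewrite indicator-no (positiveAv? τ α) (λ q → proj₂ q t) | indicator-yes (𝒬? τ μ α) (p , t , ¬μ)
          | indicator-yes (positiveAv? μ α) (p , ¬μ) = refl
  kind-μ {α} (containμ p f t m)
    rewrite indicator-no (positiveAv? τ α) (λ q → proj₂ q t) | indicator-no (𝒬? τ μ α) (λ q → proj₂ (proj₂ q) m)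
          | indicator-no (positiveAv? μ α) (λ q → proj₂ q m) = refl

  ΘG≈H : ΘG ≈ H
  ΘG≈H n M = begin
    coeff (ΘG n) M                                              ≡⟨ coeff-applyAll ops n M ⟩
    sumOver (columnsValue M ops ∘ conj ∘ parts) (partitions n)  ≡⟨ sumOver-cong (partitions n) (λ α _ → kind-value (kind α) M) ⟩
    _                                                           ≡⟨ sym (pairᴾ-H (λ i → δ i M) n) ⟩
    pairᴾ (H n) (λ i → δ i M)                                   ≡⟨ pairᴾ-coeff (H n) M ⟩
    coeff (H n) M                                               ∎
    where open ≡-Reasoning

  Fμ-at-1 : ∀ n → pairᴾ (F μ n) (λ _ → 1ℤ) ≡ pairᴾ (ΘG n) (λ _ → 1ℤ)
  Fμ-at-1 n = begin
    pairᴾ (F μ n) (λ _ → 1ℤ)                                          ≡⟨ pairᴾ-F (positiveAv? μ) (λ _ → 1ℤ) n ⟩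
    sumOver (λ α → indicator (positiveAv? μ α) *ℤ 1ℤ) (partitions n)  ≡⟨ sumOver-cong (partitions n) (λ α _ → sym (kind-μ (kind α))) ⟩
    _                                                                 ≡⟨ sym (pairᴾ-H (λ _ → 1ℤ) n) ⟩
    pairᴾ (H n) (λ _ → 1ℤ)                                            ≡⟨ sym (pairᴾ-coeff-cong (ΘG n) (H n) _ (ΘG≈H n)) ⟩
    pairᴾ (ΘG n) (λ _ → 1ℤ)                                           ∎
    where open ≡-Reasoning

  eval : ∀ p → foldr _+ℤ_ 0ℤ p ≡ pairᴾ p (λ _ → 1ℤ)
  eval p = sym (trans (pairᴾ-const p 1ℤ) (ℤₚ.*-identityʳ _))

  Fμ≈ΘG : at-t=1 (F μ) ≈ at-t=1 ΘG
  Fμ≈ΘG n m = cong (λ c → coeff (const c) m) (trans (eval (F μ n)) (trans (Fμ-at-1 n) (sym (eval (ΘG n)))))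

  avSeries≈ΘG : avSeries μ ≈ at-t=1 ΘG
  avSeries≈ΘG n m = trans (go n m) (Fμ≈ΘG n m)
    where
    size : ∀ (αs : List Partition) → pos (length αs) ≡ sumOver (λ _ → 1ℤ) αs
    size []       = refl
    size (α ∷ αs) = cong (1ℤ +ℤ_) (size αs)

    positiveAv≡ : ∀ {n} α → α ∈ partitions (suc n) → indicator (avoids? α μ) ≡ indicator (positiveAv? μ α)
    positiveAv≡ {n} α i =
      -- With the weight replaced by `suc n`, the test for positivity computes to true.
      sym (cong (λ k → indicator (0 <? k ×-dec avoids? α μ)) (∈-partitions⁻ {n = suc n} i))

    go : ∀ n m → coeff (avSeries μ n) m ≡ coeff (at-t=1 (F μ) n) m
    go zero    zero    = refl
    go zero    (suc m) = refl
    go (suc n) m       = cong (λ c → coeff (const c) m) (begin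
      pos (length (Av (suc n) μ))
        ≡⟨ size (Av (suc n) μ) ⟩
      sumOver (λ _ → 1ℤ) (Av (suc n) μ)
        ≡⟨ sumOver-filter (λ α → avoids? α μ) (λ _ → 1ℤ) (partitions (suc n)) ⟩
      sumOver (λ α → indicator (avoids? α μ) *ℤ 1ℤ) (partitions (suc n))
        ≡⟨ sumOver-cong (partitions (suc n)) (λ α i → cong (_*ℤ 1ℤ) (positiveAv≡ {n} α i)) ⟩
      sumOver (λ α → indicator (positiveAv? μ α) *ℤ 1ℤ) (partitions (suc n))
        ≡⟨ sym (pairᴾ-F (positiveAv? μ) (λ _ → 1ℤ) (suc n)) ⟩
      pairᴾ (F μ (suc n)) (λ _ → 1ℤ)
        ≡⟨ sym (eval (F μ (suc n))) ⟩
      foldr _+ℤ_ 0ℤ (F μ (suc n)) ∎)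
      where open ≡-Reasoning

mainTheorem1 : (μ : Partition) (ss : SuperStrict μ) (w : 2 ≤ weight μ) →
    let τ = decrementFirst μ ss w
        ΘG = applyAll (Θ μ) ((z^ 1 t^ 1) ⊛ (1/1-z^ 1 t^ 1))
    in (ΘG ≈ at-t=1 (F τ) ⊕ F₂ τ μ)
       × (at-t=1 (F μ) ≈ at-t=1 ΘG)
       × (avSeries μ ≈ at-t=1 ΘG)
mainTheorem1 μ ss w = ΘG≈H μ ss w , Fμ≈ΘG μ ss w , avSeries≈ΘG μ ss w
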